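{- Let $s\ge 2$ and $n_1,\ldots,n_s\ge 1$ be integers, let $n=n_1+\cdots+n_s$, and let $K_{n_1,\ldots,n_s}$ be the complete $s$-partite graph with partition sets $X_1,\ldots,X_s$, $|X_i|=n_i$. Let $F$ be a spanning forest of $K_{n_1,\ldots,n_s}$ with components $T_1,\ldots,T_c$. For $i\in\{1,\ldots,s\}$ and $p\in\{1,\ldots,c\}$ put $n_{ip}=|X_i\cap V(T_p)|$, $m_p=|V(T_p)|$ and $\alpha_p=nm_p-\sum_{i=1}^s n_in_{ip}$. Let $M$ be the $s\times s$ matrix whose $(k,l)$ entry is $$M_{kl}=\delta_{kl}-\sum_{p=1}^c\frac{n_{lp}(m_p-n_{kp})}{\alpha_p}.$$ Then for any $i,j\in\{1,\ldots,s\}$, $$\tau_F(K_{n_1,\ldots,n_s})=\frac{C_{ij}}{n_i(n-n_j)}\prod_{p=1}^c\alpha_p,$$ where $C_{ij}$ is the cofactor of $M$ corresponding to the $(i,j)$ entry.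
   Context: For a graph $G$ and a spanning subgraph $H$, $\tau_H(G)$ denotes the number of spanning trees of $G$ that contain all edges of $H$. $\delta_{kl}$ is the Kronecker delta. The cofactor $C_{ij}$ of an $s\times s$ matrix $M$ is $(-1)^{i+j}$ times the determinant of the matrix obtained from $M$ by deleting row $i$ and column $j$. -}

module Defs where

open import Data.Bool using (Bool; true; false; if_then_else_; _∧_)
open import Data.Nat as ℕ using (ℕ; zero; suc; _≤_)
open import Data.Fin as Fin using (Fin; zero; suc; toℕ; punchIn; _≟_)
open import Data.Vec using (Vec; lookup)
open import Data.List using (List; []; _∷_; _++_; length)
open import Data.List.Relation.Unary.Unique.Propositional using (Unique)
open import Data.List.Relation.Unary.Linked using (Linked)
open import Data.Integer using (+_; +[1+_]; -[1+_])
open import Data.Rational as ℚ using (ℚ; mkℚ; 0ℚ; 1ℚ; _+_; _*_; _-_; -_; 1/_)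
open import Data.Product using (Σ; ∃; _×_; _,_)
open import Data.Empty using (⊥)
open import Relation.Nullary using (¬_; Dec; yes; no)
open import Relation.Nullary.Decidable using (⌊_⌋)
open import Relation.Binary.PropositionalEquality using (_≡_; _≢_)
open import Function.Bundles using (_⇔_; _↔_)

Graph : ℕ → Set
Graph n = Vec (Vec Bool n) n

Adj : ∀ {n} → Graph n → Fin n → Fin n → Set
Adj A u v = lookup (lookup A u) v ≡ true

IsSimple : ∀ {n} → Graph n → Set
IsSimple A = (∀ u v → Adj A u v → Adj A v u) × (∀ u → ¬ Adj A u u)

_⊆ᴳ_ : ∀ {n} → Graph n → Graph n → Set
H ⊆ᴳ G = ∀ u v → Adj H u v → Adj G u v

IsCompleteMultipartite : ∀ {n s} → (Fin n → Fin s) → Graph n → Set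
IsCompleteMultipartite part G = ∀ u v → Adj G u v ⇔ (part u ≢ part v)

data Reach {n} (A : Graph n) : Fin n → Fin n → Set where
  here : ∀ {u} → Reach A u u
  step : ∀ {u w v} → Adj A u w → Reach A w v → Reach A u v

Connected : ∀ {n} → Graph n → Set
Connected A = ∀ u v → Reach A u v

HasCycle : ∀ {n} → Graph n → Set
HasCycle A = ∃ λ v → ∃ λ vs →
  (2 ≤ length vs) × Unique (v ∷ vs) × Linked (Adj A) (v ∷ vs ++ v ∷ [])

Acyclic : ∀ {n} → Graph n → Set
Acyclic A = ¬ HasCycle A

IsSpanningForest : ∀ {n} → Graph n → Graph n → Set
IsSpanningForest G F = IsSimple F × F ⊆ᴳ G × Acyclic F

IsSpanningTree : ∀ {n} → Graph n → Graph n → Set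
IsSpanningTree G T = IsSimple T × T ⊆ᴳ G × Connected T × Acyclic T

IsComponentLabelling : ∀ {n c} → Graph n → (Fin n → Fin c) → Set
IsComponentLabelling F comp =
  (∀ u v → (comp u ≡ comp v) ⇔ Reach F u v) × (∀ p → ∃ λ v → comp v ≡ p)

count : ∀ {n} → (Fin n → Bool) → ℕ
count {zero}  P = 0
count {suc n} P = (if P zero then 1 else 0) ℕ.+ count (λ i → P (suc i))

HasSize : ∀ {a} → Set a → ℕ → Set a
HasSize A N = Fin N ↔ A

sumℚ : ∀ {k} → (Fin k → ℚ) → ℚ
sumℚ {zero}  f = 0ℚ
sumℚ {suc k} f = f zero + sumℚ (λ i → f (suc i))

prodℚ : ∀ {k} → (Fin k → ℚ) → ℚ
prodℚ {zero}  f = 1ℚ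
prodℚ {suc k} f = f zero * prodℚ (λ i → f (suc i))

ℕ→ℚ : ℕ → ℚ
ℕ→ℚ k = + k ℚ./ 1

-- total reciprocal (1/0 := 0); only ever applied to nonzero values below
inv : ℚ → ℚ
inv q@(mkℚ (+ 0) _ _) = 0ℚ
inv q@(mkℚ +[1+ _ ] _ _) = 1/ q
inv q@(mkℚ -[1+ _ ] _ _) = 1/ q

_÷₀_ : ℚ → ℚ → ℚ
p ÷₀ q = p * inv q

sign : ℕ → ℚ
sign zero = 1ℚ
sign (suc k) = - sign k

δ : ∀ {s} → Fin s → Fin s → ℚ
δ k l = if ⌊ k ≟ l ⌋ then 1ℚ else 0ℚ

Matrix : ℕ → Set
Matrix s = Fin s → Fin s → ℚ

minor : ∀ {s} → Fin (suc s) → Fin (suc s) → Matrix (suc s) → Matrix s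
minor i j A k l = A (punchIn i k) (punchIn j l)

det : ∀ {s} → Matrix s → ℚ
det {zero}  A = 1ℚ
det {suc s} A = sumℚ (λ j → sign (toℕ j) * A zero j * det (minor zero j A))

cofactor : ∀ {s} → Matrix s → Fin s → Fin s → ℚ
cofactor {suc s} A i j = sign (toℕ i ℕ.+ toℕ j) * det (minor i j A)

nᵢ : ∀ {n s} → (Fin n → Fin s) → Fin s → ℕ
nᵢ part i = count (λ v → ⌊ part v ≟ i ⌋)

module Setup {n s c : ℕ} (part : Fin n → Fin s) (comp : Fin n → Fin c) where

  nip : Fin s → Fin c → ℕ
  nip i p = count (λ v → ⌊ part v ≟ i ⌋ ∧ ⌊ comp v ≟ p ⌋)

  m : Fin c → ℕ
  m p = count (λ v → ⌊ comp v ≟ p ⌋)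

  α : Fin c → ℚ
  α p = ℕ→ℚ (n ℕ.* m p) - sumℚ (λ i → ℕ→ℚ (nᵢ part i ℕ.* nip i p))

  M : Matrix s
  M k l = δ k l - sumℚ (λ p → (ℕ→ℚ (nip l p) * (ℕ→ℚ (m p) - ℕ→ℚ (nip k p))) ÷₀ α p)

-- Contracting the components of F turns K into a multigraph on {1,…,c} with Laplacian
-- L = diag(α) − Nᵀ(J − I)N, where N = (n_ip). Weight the vertices by û and v̂ and border the
-- Laplacian with the component sums of these weights. Deleting and contracting an edge changes
-- the bordered determinant exactly as it changes the number of trees (contraction adds the
-- weights of the merged components), so that this determinant is −(Σû)(Σv̂)τ_F.
-- Taking for û the indicator of X_i and for v̂ the indicator of the complement of X_j, scaled by −t,
-- the bordered matrix has the form D − AB with D = diag(1, α), and det(D − AB) = det D · det(1 − BD⁻¹A)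
-- turns its determinant into ∏α · det(M + t e_i e_jᵀ) = ∏α · (det M + t C_ij).
-- Both sides are linear in t; comparing the values at t = 1 and t = 0 gives the formula.
{-# OPTIONS --safe #-}
module Submission where

open import Defs
open import Data.Nat using (ℕ; _≤_)
open import Data.Fin using (Fin)
open import Data.Product using (∃; _×_)
open import Data.Rational using (ℚ; _*_; _-_)
open import Data.Refinement using (Refinement-syntax)
open import Relation.Binary.PropositionalEquality using (_≡_)

open import Data.Bool using (Bool; true; false; if_then_else_; _∧_; _∨_)
import Data.Bool.Properties as Bool
open import Data.Fin as Fin using (zero; suc; toℕ; fromℕ<; punchIn; punchOut; pinch; splitAt; join; _↑ˡ_; _↑ʳ_; _≟_; _<?_)
import Data.Fin.Properties as Fin
open import Data.Integer as ℤ using (+0; +[1+_]; -[1+_])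
import Data.Integer.Properties as ℤ
open import Data.Irrelevant using ([_])
open import Data.List as List using (List; []; _∷_; _++_; length; foldr; filter; cartesianProduct; allFin)
import Data.List.Properties as List
open import Data.List.Membership.Propositional using (_∈_; lose)
open import Data.List.Membership.Propositional.Properties using (∈-++⁺ˡ; ∈-++⁺ʳ; ∈-++⁻; ∈-filter⁺; ∈-cartesianProduct⁺; ∈-allFin; ∈-lookup)
import Data.List.Membership.DecPropositional as DecMembership
open import Data.List.Relation.Unary.All as All using (All; []; _∷_)
import Data.List.Relation.Unary.All.Properties as All
open import Data.List.Relation.Unary.AllPairs using (AllPairs; []; _∷_)
open import Data.List.Relation.Unary.Any using (Any; here; there; index)
open import Data.List.Relation.Unary.Any.Properties using (lookup-index)
open import Data.List.Relation.Unary.Linked as Linked using (Linked; [-]; _∷_)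
open import Data.List.Relation.Unary.Unique.Propositional using (Unique)
import Data.List.Relation.Unary.Unique.Propositional.Properties as Unique
open import Data.Nat as ℕ using (zero; suc; z≤n; s≤s)
import Data.Nat.Properties as ℕ
open import Data.Product using (_,_; proj₁; proj₂)
open import Data.Rational as ℚ using (0ℚ; 1ℚ; ½; mkℚ; toℚᵘ; _+_; -_)
import Data.Rational.Properties as ℚ
open import Data.Rational.Solver using (module +-*-Solver)
import Data.Rational.Unnormalised as ℚᵘ
import Data.Rational.Unnormalised.Properties as ℚᵘ
open import Data.Refinement using (value; _,_; value-injective)
open import Data.Sum as Sum using (_⊎_; inj₁; inj₂)
open import Data.Vec using (Vec; lookup; tabulate)
import Data.Vec.Properties as Vec
open import Data.Vec.Functional using (updateAt)
open import Data.Vec.Functional.Properties using (updateAt-updates; updateAt-minimal)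
open import Function using (_∘_; id; const)
open import Function.Bundles using (mk↔ₛ′; Equivalence)
open import Level using (0ℓ)
open import Relation.Binary.Construct.Closure.ReflexiveTransitive as Star using (Star; ε; _◅_; _◅◅_)
open import Relation.Binary.Core using (Rel)
open import Relation.Binary.Definitions using (DecidableEquality; tri<; tri≈; tri>)
open import Relation.Binary.PropositionalEquality hiding ([_])
open import Relation.Nullary using (¬_; Dec; yes; no; does; contradiction)
open import Relation.Nullary.Decidable using (_×-dec_; _⊎-dec_; ⌊_⌋; dec-true; dec-false)
open import Relation.Nullary.Negation using (contradiction-irr)
open import Relation.Unary using (Decidable)
open ≡-Reasoning
open +-*-Solver using (solve; con; _:+_; _:*_; _:-_; :-_; _:=_)

-- The Laplacian of the contracted graph is singular, and so is `M`: the value at t = 0 says that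
-- det M = 0, and the count sits in the cofactors. A border with independent weights for its column
-- and its row probes a row index i and a column index j at once, and so reaches every cofactor
-- C_ij, not only the principal ones. The corner of the border is a free parameter `d`. It does not
-- influence the determinant, because its own cofactor is the determinant of the singular Laplacian;
-- the corner 1 + tδ_ij that the shape D - AB dictates is therefore harmless. No graph is ever
-- contracted. The vertex set stays `Fin n`, and only the labelling of the components becomes
-- coarser. The trees are listed by the same recursion on the edges that evaluates the determinant,
-- so the count is the length of a list; the combinatorial work is to show that this list contains
-- every tree exactly once.

sum-cong : ∀ {k} {f g : Fin k → ℚ} → (∀ i → f i ≡ g i) → sumℚ f ≡ sumℚ g
sum-cong {zero}  h = refl
sum-cong {suc k} h = cong₂ _+_ (h zero) (sum-cong (h ∘ suc))

sum-zero : ∀ k → sumℚ {k} (λ _ → 0ℚ) ≡ 0ℚ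
sum-zero zero    = refl
sum-zero (suc k) = cong (0ℚ +_) (sum-zero k)

sum-≡0 : ∀ {k} {f : Fin k → ℚ} → (∀ i → f i ≡ 0ℚ) → sumℚ f ≡ 0ℚ
sum-≡0 {k} h = trans (sum-cong h) (sum-zero k)

sum-+ : ∀ {k} (f g : Fin k → ℚ) → sumℚ (λ i → f i + g i) ≡ sumℚ f + sumℚ g
sum-+ {zero}  f g = refl
sum-+ {suc k} f g = trans (cong (f zero + g zero +_) (sum-+ (f ∘ suc) (g ∘ suc)))
  (solve 4 (λ a b c d → (a :+ b) :+ (c :+ d) := (a :+ c) :+ (b :+ d)) refl
    (f zero) (g zero) (sumℚ (f ∘ suc)) (sumℚ (g ∘ suc)))

sum-*ˡ : ∀ {k} x (f : Fin k → ℚ) → sumℚ (λ i → x * f i) ≡ x * sumℚ f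
sum-*ˡ {zero}  x f = sym (ℚ.*-zeroʳ x)
sum-*ˡ {suc k} x f = trans (cong (x * f zero +_) (sum-*ˡ x (f ∘ suc))) (sym (ℚ.*-distribˡ-+ x _ _))

sum-*ʳ : ∀ {k} x (f : Fin k → ℚ) → sumℚ (λ i → f i * x) ≡ sumℚ f * x
sum-*ʳ x f = trans (sum-cong λ i → ℚ.*-comm (f i) x) (trans (sum-*ˡ x f) (ℚ.*-comm x _))

sum-neg : ∀ {k} (f : Fin k → ℚ) → sumℚ (λ i → - f i) ≡ - sumℚ f
sum-neg {zero}  f = refl
sum-neg {suc k} f = trans (cong (- f zero +_) (sum-neg (f ∘ suc))) (sym (ℚ.neg-distrib-+ (f zero) (sumℚ (f ∘ suc))))

sum-- : ∀ {k} (f g : Fin k → ℚ) → sumℚ (λ i → f i - g i) ≡ sumℚ f - sumℚ g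
sum-- f g = trans (sum-+ f (λ i → - g i)) (cong (sumℚ f +_) (sum-neg g))

sum-swap : ∀ {k l} (f : Fin k → Fin l → ℚ) →
  sumℚ (λ i → sumℚ (f i)) ≡ sumℚ (λ j → sumℚ (λ i → f i j))
sum-swap {zero}  {l} f = sym (sum-zero l)
sum-swap {suc k} f = trans (cong (sumℚ (f zero) +_) (sum-swap (f ∘ suc))) (sym (sum-+ (f zero) _))

sum₂-+ : ∀ {k l} (f g : Fin k → Fin l → ℚ) →
  sumℚ (λ i → sumℚ (λ j → f i j + g i j)) ≡ sumℚ (λ i → sumℚ (f i)) + sumℚ (λ i → sumℚ (g i))
sum₂-+ f g = trans (sum-cong λ i → sum-+ (f i) (g i)) (sum-+ (λ i → sumℚ (f i)) (λ i → sumℚ (g i)))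

sum-splitAt : ∀ c {s} (f : Fin c ⊎ Fin s → ℚ) →
  sumℚ (f ∘ splitAt c) ≡ sumℚ (f ∘ inj₁) + sumℚ (f ∘ inj₂)
sum-splitAt zero    f = sym (ℚ.+-identityˡ _)
sum-splitAt (suc c) f = trans (cong (f (inj₁ zero) +_) (sum-splitAt c (f ∘ Sum.map suc id)))
  (sym (ℚ.+-assoc (f (inj₁ zero)) (sumℚ (f ∘ inj₁ ∘ suc)) (sumℚ (f ∘ inj₂))))

sum-↑ : ∀ c {s} (f : Fin (c ℕ.+ s) → ℚ) →
  sumℚ f ≡ sumℚ (λ i → f (i ↑ˡ s)) + sumℚ (λ k → f (c ↑ʳ k))
sum-↑ c {s} f = trans (sum-cong λ i → cong f (sym (Fin.join-splitAt c s i))) (sum-splitAt c (f ∘ join c s))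

sum-0* : ∀ {k} (f : Fin k → ℚ) → sumℚ (λ i → 0ℚ * f i) ≡ 0ℚ
sum-0* f = sum-≡0 λ i → ℚ.*-zeroˡ (f i)

-- The Kronecker delta and the embedding of the natural numbers

δ-refl : ∀ {k} (i : Fin k) → δ i i ≡ 1ℚ
δ-refl i with i ≟ i
... | yes _  = refl
... | no i≢i = contradiction refl i≢i

δ-≢ : ∀ {k} {i j : Fin k} → i ≢ j → δ i j ≡ 0ℚ
δ-≢ {i = i} {j} i≢j with i ≟ j
... | yes i≡j = contradiction i≡j i≢j
... | no _    = refl

δ-sym : ∀ {k} (i j : Fin k) → δ i j ≡ δ j i
δ-sym i j with i ≟ j
... | yes refl = sym (δ-refl i)
... | no i≢j   = sym (δ-≢ (i≢j ∘ sym))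

δ-cong : ∀ {k l} {i j : Fin k} {i′ j′ : Fin l} → (i ≡ j → i′ ≡ j′) → (i′ ≡ j′ → i ≡ j) → δ i j ≡ δ i′ j′
δ-cong {i = i} {j} {i′} to from with i ≟ j
... | yes i≡j = sym (trans (cong (δ i′) (sym (to i≡j))) (δ-refl i′))
... | no i≢j  = sym (δ-≢ (i≢j ∘ from))

δ-suc : ∀ {k} (i j : Fin k) → δ (suc i) (suc j) ≡ δ i j
δ-suc i j = δ-cong Fin.suc-injective (cong suc)

sum-δ : ∀ {k} (i : Fin k) (f : Fin k → ℚ) → sumℚ (λ j → δ i j * f j) ≡ f i
sum-δ zero f = begin
  1ℚ * f zero + sumℚ (λ j → 0ℚ * f (suc j)) ≡⟨ cong₂ _+_ (ℚ.*-identityˡ (f zero)) (sum-≡0 λ j → ℚ.*-zeroˡ (f (suc j))) ⟩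
  f zero + 0ℚ                               ≡⟨ ℚ.+-identityʳ (f zero) ⟩
  f zero                                    ∎
sum-δ (suc i) f = begin
  0ℚ * f zero + sumℚ (λ j → δ (suc i) (suc j) * f (suc j)) ≡⟨ cong₂ _+_ (ℚ.*-zeroˡ (f zero)) (sum-cong λ j → cong (_* f (suc j)) (δ-suc i j)) ⟩
  0ℚ + sumℚ (λ j → δ i j * f (suc j))                      ≡⟨ ℚ.+-identityˡ _ ⟩
  sumℚ (λ j → δ i j * f (suc j))                           ≡⟨ sum-δ i (f ∘ suc) ⟩
  f (suc i)                                                ∎

δ-diagonal : ∀ {k} (r p q : Fin k) → δ r p * δ r q ≡ δ p q * δ r p
δ-diagonal r p q with r ≟ p
... | yes refl = ℚ.*-comm 1ℚ (δ r q)
... | no _     = trans (ℚ.*-zeroˡ (δ r q)) (sym (ℚ.*-zeroʳ (δ p q)))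

x≡-x⇒x≡0 : ∀ {x} → x ≡ - x → x ≡ 0ℚ
x≡-x⇒x≡0 {x} eq = begin
  x              ≡⟨ solve 1 (λ x → x := con ½ :* (x :+ x)) refl x ⟩
  ½ * (x + x)    ≡⟨ cong (λ y → ½ * (x + y)) eq ⟩
  ½ * (x - x)    ≡⟨ solve 1 (λ x → con ½ :* (x :- x) := con 0ℚ) refl x ⟩
  0ℚ             ∎

-- `ℕ→ℚ` normalises by a gcd that does not reduce for a variable `k`, so additivity is checked on
-- unnormalised fractions, where it is an integer identity.
toℚᵘ-ℕ→ℚ : ∀ k → toℚᵘ (ℕ→ℚ k) ℚᵘ.≃ ℚᵘ.mkℚᵘ (ℤ.+ k) 0
toℚᵘ-ℕ→ℚ k = ℚ.toℚᵘ-fromℚᵘ (ℚᵘ.mkℚᵘ (ℤ.+ k) 0)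

ℕ→ℚ-+ : ∀ a b → ℕ→ℚ (a ℕ.+ b) ≡ ℕ→ℚ a + ℕ→ℚ b
ℕ→ℚ-+ a b = ℚ.toℚᵘ-injective (begin′
  toℚᵘ (ℕ→ℚ (a ℕ.+ b))                      ≈⟨ toℚᵘ-ℕ→ℚ (a ℕ.+ b) ⟩
  ℚᵘ.mkℚᵘ (ℤ.+ (a ℕ.+ b)) 0                   ≈⟨ ℚᵘ.*≡* (cong₂ (λ x y → (x ℤ.+ y) ℤ.* ℤ.+ 1) (sym (ℤ.*-identityʳ (ℤ.+ a))) (sym (ℤ.*-identityʳ (ℤ.+ b)))) ⟩
  ℚᵘ.mkℚᵘ (ℤ.+ a) 0 ℚᵘ.+ ℚᵘ.mkℚᵘ (ℤ.+ b) 0      ≈⟨ ℚᵘ.+-cong (toℚᵘ-ℕ→ℚ a) (toℚᵘ-ℕ→ℚ b) ⟨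
  toℚᵘ (ℕ→ℚ a) ℚᵘ.+ toℚᵘ (ℕ→ℚ b)            ≈⟨ ℚ.toℚᵘ-homo-+ (ℕ→ℚ a) (ℕ→ℚ b) ⟨
  toℚᵘ (ℕ→ℚ a + ℕ→ℚ b)                      ∎′)
  where
  open import Relation.Binary.Reasoning.Setoid ℚᵘ.≃-setoid using (step-≈-⟩; step-≈-⟨) renaming (begin_ to begin′_; _∎ to _∎′)

ℕ→ℚ-* : ∀ a b → ℕ→ℚ (a ℕ.* b) ≡ ℕ→ℚ a * ℕ→ℚ b
ℕ→ℚ-* zero    b = sym (ℚ.*-zeroˡ (ℕ→ℚ b))
ℕ→ℚ-* (suc a) b = begin
  ℕ→ℚ (b ℕ.+ a ℕ.* b)        ≡⟨ ℕ→ℚ-+ b (a ℕ.* b) ⟩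
  ℕ→ℚ b + ℕ→ℚ (a ℕ.* b)      ≡⟨ cong (ℕ→ℚ b +_) (ℕ→ℚ-* a b) ⟩
  ℕ→ℚ b + ℕ→ℚ a * ℕ→ℚ b      ≡⟨ solve 2 (λ a b → b :+ a :* b := (con 1ℚ :+ a) :* b) refl (ℕ→ℚ a) (ℕ→ℚ b) ⟩
  (1ℚ + ℕ→ℚ a) * ℕ→ℚ b       ≡⟨ cong (_* ℕ→ℚ b) (ℕ→ℚ-+ 1 a) ⟨
  ℕ→ℚ (suc a) * ℕ→ℚ b        ∎

-- Determinants

-- The ordered pairs of distinct elements of Fin (1 + n) are the pairs (l , punchIn l k);
-- reversing such a pair sends (l , k) to (punchIn l k , pinch k l).
sum-reverse-pairs : ∀ {n} (f : Fin (suc n) → Fin n → ℚ) →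
  sumℚ (λ l → sumℚ (f l)) ≡ sumℚ (λ l → sumℚ (λ k → f (punchIn l k) (pinch k l)))
sum-reverse-pairs {zero}  f = refl
sum-reverse-pairs {suc n} f = begin
  a + sumℚ (λ l → f (suc l) zero + sumℚ (λ k → f (suc l) (suc k)))
    ≡⟨ cong (a +_) (sum-+ (λ l → f (suc l) zero) (λ l → sumℚ (λ k → f (suc l) (suc k)))) ⟩
  a + (b + sumℚ (λ l → sumℚ (λ k → f (suc l) (suc k))))
    ≡⟨ cong (λ x → a + (b + x)) (sum-reverse-pairs (λ l k → f (suc l) (suc k))) ⟩
  a + (b + c)
    ≡⟨ solve 3 (λ a b c → a :+ (b :+ c) := b :+ (a :+ c)) refl a b c ⟩
  b + (a + c)
    ≡⟨ cong (b +_) (sym (sum-+ (f zero) (λ l → sumℚ (λ k → f (suc (punchIn l k)) (suc (pinch k l)))))) ⟩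
  b + sumℚ (λ l → f zero l + sumℚ (λ k → f (suc (punchIn l k)) (suc (pinch k l)))) ∎
  where
  a = sumℚ (f zero)
  b = sumℚ (λ l → f (suc l) zero)
  c = sumℚ (λ l → sumℚ (λ k → f (suc (punchIn l k)) (suc (pinch k l))))

punchIn-pinch : ∀ {n} (l : Fin (suc n)) (k : Fin n) → punchIn (punchIn l k) (pinch k l) ≡ l
punchIn-pinch zero    zero    = refl
punchIn-pinch zero    (suc k) = refl
punchIn-pinch (suc l) zero    = refl
punchIn-pinch (suc l) (suc k) = cong suc (punchIn-pinch l k)

-- Removing two columns in either order leaves the same columns in the same order; this identifies
-- the double minors of a pair and of its reversal.
punchIn-punchIn : ∀ {n} (l : Fin (suc (suc n))) (k : Fin (suc n)) (x : Fin n) →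
  punchIn (punchIn l k) (punchIn (pinch k l) x) ≡ punchIn l (punchIn k x)
punchIn-punchIn zero    zero    x       = refl
punchIn-punchIn zero    (suc k) x       = refl
punchIn-punchIn (suc l) zero    x       = refl
punchIn-punchIn (suc l) (suc k) zero    = refl
punchIn-punchIn (suc l) (suc k) (suc x) = cong suc (punchIn-punchIn l k x)

sign-+ : ∀ a b → sign (a ℕ.+ b) ≡ sign a * sign b
sign-+ zero    b = sym (ℚ.*-identityˡ _)
sign-+ (suc a) b = trans (cong -_ (sign-+ a b)) (ℚ.neg-distribˡ-* (sign a) (sign b))

sign-square : ∀ a → sign a * sign a ≡ 1ℚ
sign-square zero    = refl
sign-square (suc a) = trans (solve 1 (λ x → (:- x) :* (:- x) := x :* x) refl (sign a)) (sign-square a)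

sgn : ∀ {n} → Fin n → ℚ
sgn i = sign (toℕ i)

-- Reversal changes the sum of the two positions by exactly one: they become k + 1 and l when l ≤ k,
-- and k and l - 1 otherwise.
sgn-reverse-pair : ∀ {n} (l : Fin (suc n)) (k : Fin n) → sgn (punchIn l k) * sgn (pinch k l) ≡ - (sgn l * sgn k)
sgn-reverse-pair zero k@zero    = refl
sgn-reverse-pair zero k@(suc _) = solve 1 (λ x → (:- x) :* con 1ℚ := :- (con 1ℚ :* x)) refl (sgn k)
sgn-reverse-pair (suc l) zero   = solve 1 (λ x → con 1ℚ :* x := :- ((:- x) :* con 1ℚ)) refl (sgn l)
sgn-reverse-pair (suc l) (suc k) = begin
  (- sgn (punchIn l k)) * (- sgn (pinch k l)) ≡⟨ solve 2 (λ x y → (:- x) :* (:- y) := x :* y) refl (sgn (punchIn l k)) (sgn (pinch k l)) ⟩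
  sgn (punchIn l k) * sgn (pinch k l)         ≡⟨ sgn-reverse-pair l k ⟩
  - (sgn l * sgn k)                           ≡⟨ solve 2 (λ x y → :- (x :* y) := :- ((:- x) :* (:- y))) refl (sgn l) (sgn k) ⟩
  - ((- sgn l) * (- sgn k))                   ∎

det-cong : ∀ {n} {A B : Matrix n} → (∀ r c → A r c ≡ B r c) → det A ≡ det B
det-cong {zero}  h = refl
det-cong {suc n} h = sum-cong λ j →
  cong₂ _*_ (cong (sgn j *_) (h zero j)) (det-cong λ r c → h (suc r) (punchIn j c))

rowTerm : ∀ {n} → Matrix (suc n) → Fin (suc n) → Fin (suc n) → ℚ
rowTerm A i j = sgn i * sgn j * A i j * det (minor i j A)

-- The summand of the simultaneous expansion along the rows 0 and 1 + i.
pairTerm : ∀ {n} → Matrix (suc (suc n)) → Fin (suc n) → Fin (suc (suc n)) → Fin (suc n) → ℚ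
pairTerm A i l k =
  sgn l * A zero l * (sgn i * sgn k * A (suc i) (punchIn l k) * det (minor i k (minor zero l A)))

det-minor-reverse : ∀ {n} (A : Matrix (suc (suc n))) i l k →
  det (minor i (pinch k l) (minor zero (punchIn l k) A)) ≡ det (minor i k (minor zero l A))
det-minor-reverse A i l k = det-cong λ r c → cong (A (suc (punchIn i r))) (punchIn-punchIn l k c)

-- Expand along row zero, and each minor along row `i` by induction. Reversing the pairs of columns
-- makes the entry of row 1 + i the outer one, and the sign of the reversal is the extra sign of
-- `suc i`. The inner sum is then the expansion of `minor (suc i) l A` along its row zero.
det-row : ∀ {n} (A : Matrix (suc n)) i → det A ≡ sumℚ (rowTerm A i)
det-pair : ∀ {n} (A : Matrix (suc (suc n))) i → det A ≡ sumℚ (λ l → sumℚ (pairTerm A i l))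

det-pair A i = sum-cong λ l →
  trans (cong (sgn l * A zero l *_) (det-row (minor zero l A) i))
        (sym (sum-*ˡ (sgn l * A zero l) (rowTerm (minor zero l A) i)))

det-row A zero = sum-cong λ j → cong (λ x → x * A zero j * det (minor zero j A)) (sym (ℚ.*-identityˡ (sgn j)))
det-row {suc n} A (suc i) = begin
  det A
    ≡⟨ det-pair A i ⟩
  sumℚ (λ l → sumℚ (pairTerm A i l))
    ≡⟨ sum-reverse-pairs (pairTerm A i) ⟩
  sumℚ (λ l → sumℚ (λ k → pairTerm A i (punchIn l k) (pinch k l)))
    ≡⟨ sum-cong (λ l → trans (sum-cong (swapped l)) (sum-*ˡ (- sgn i * sgn l * A (suc i) l) (row₀Term l))) ⟩
  sumℚ (rowTerm A (suc i)) ∎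
  where
  row₀Term : Fin (suc (suc n)) → Fin (suc n) → ℚ
  row₀Term l k = sgn k * A zero (punchIn l k) * det (minor i k (minor zero l A))
  swapped : ∀ l k → pairTerm A i (punchIn l k) (pinch k l) ≡
    - sgn i * sgn l * A (suc i) l * (sgn k * A zero (punchIn l k) * det (minor i k (minor zero l A)))
  swapped l k = begin
    pairTerm A i (punchIn l k) (pinch k l)
      ≡⟨ cong₂ (λ c d → sp * a * (sgn i * sq * A (suc i) c * d)) (punchIn-pinch l k) (det-minor-reverse A i l k) ⟩
    sp * a * (sgn i * sq * b * D)
      ≡⟨ solve 6 (λ p a i q b D → p :* a :* (i :* q :* b :* D) := (p :* q) :* a :* (i :* b :* D)) refl sp a (sgn i) sq b D ⟩
    (sp * sq) * a * (sgn i * b * D)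
      ≡⟨ cong (λ x → x * a * (sgn i * b * D)) (sgn-reverse-pair l k) ⟩
    - (sgn l * sgn k) * a * (sgn i * b * D)
      ≡⟨ solve 6 (λ l k a i b D → :- (l :* k) :* a :* (i :* b :* D) := (:- i) :* l :* b :* (k :* a :* D)) refl (sgn l) (sgn k) a (sgn i) b D ⟩
    - sgn i * sgn l * b * (sgn k * a * D) ∎
    where
    sp = sgn (punchIn l k)
    sq = sgn (pinch k l)
    a = A zero (punchIn l k)
    b = A (suc i) l
    D = det (minor i k (minor zero l A))

-- When the two rows agree, reversing a pair of columns only negates its term in the expansion along
-- both rows, so the determinant equals its own negative.
det-equal-row₀ : ∀ {n} (A : Matrix (suc n)) j → (∀ c → A zero c ≡ A (suc j) c) → det A ≡ 0ℚ
det-equal-row₀ {suc n} A j h = x≡-x⇒x≡0 (begin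
  det A
    ≡⟨ det-pair A j ⟩
  sumℚ (λ l → sumℚ (pairTerm A j l))
    ≡⟨ sum-reverse-pairs (pairTerm A j) ⟩
  sumℚ (λ l → sumℚ (λ k → pairTerm A j (punchIn l k) (pinch k l)))
    ≡⟨ sum-cong (λ l → trans (sum-cong (swapped l)) (sum-neg (pairTerm A j l))) ⟩
  sumℚ (λ l → - sumℚ (pairTerm A j l))
    ≡⟨ sum-neg (λ l → sumℚ (pairTerm A j l)) ⟩
  - sumℚ (λ l → sumℚ (pairTerm A j l))
    ≡⟨ cong -_ (sym (det-pair A j)) ⟩
  - det A ∎)
  where
  swapped : ∀ l k → pairTerm A j (punchIn l k) (pinch k l) ≡ - pairTerm A j l k
  swapped l k = begin
    pairTerm A j (punchIn l k) (pinch k l)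
      ≡⟨ cong₂ (λ c d → sp * A zero p * (sgn j * sq * c * d))
           (trans (cong (A (suc j)) (punchIn-pinch l k)) (sym (h l))) (det-minor-reverse A j l k) ⟩
    sp * A zero p * (sgn j * sq * a * D)
      ≡⟨ cong (λ x → sp * x * (sgn j * sq * a * D)) (h p) ⟩
    sp * b * (sgn j * sq * a * D)
      ≡⟨ solve 6 (λ p a i q b D → p :* b :* (i :* q :* a :* D) := (p :* q) :* b :* (i :* a :* D)) refl sp a (sgn j) sq b D ⟩
    (sp * sq) * b * (sgn j * a * D)
      ≡⟨ cong (λ x → x * b * (sgn j * a * D)) (sgn-reverse-pair l k) ⟩
    - (sgn l * sgn k) * b * (sgn j * a * D)
      ≡⟨ solve 6 (λ l k a i b D → :- (l :* k) :* b :* (i :* a :* D) := :- (l :* a :* (i :* k :* b :* D))) refl (sgn l) (sgn k) a (sgn j) b D ⟩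
    - pairTerm A j l k ∎
    where
    p = punchIn l k
    sp = sgn p
    sq = sgn (pinch k l)
    a = A zero l
    b = A (suc j) p
    D = det (minor j k (minor zero l A))

det-equal-rows : ∀ {n} (A : Matrix n) {i j} → i ≢ j → (∀ c → A i c ≡ A j c) → det A ≡ 0ℚ
det-equal-rows A {zero}  {zero}  i≢j h = contradiction refl i≢j
det-equal-rows A {zero}  {suc j} i≢j h = det-equal-row₀ A j h
det-equal-rows A {suc i} {zero}  i≢j h = det-equal-row₀ A i (sym ∘ h)
det-equal-rows {suc n} A {suc i} {suc j} i≢j h = sum-≡0 λ l →
  trans (cong (sgn l * A zero l *_) (det-equal-rows (minor zero l A) (i≢j ∘ cong suc) (λ c → h (punchIn l c))))
        (ℚ.*-zeroʳ (sgn l * A zero l))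

-- Every minor of the first row except the first is expanded along its first column, and the two
-- sums are interchanged. This makes transposition compatible with the recursion that defines `det`.
det-col₀ : ∀ {n} (A : Matrix (suc n)) → det A ≡ sumℚ (λ i → sgn i * A i zero * det (minor i zero A))
det-col₀ {zero}  A = refl
det-col₀ {suc n} A = cong (1ℚ * A zero zero * det (minor zero zero A) +_) (begin
  sumℚ (λ j → - sgn j * A zero (suc j) * det (minor zero (suc j) A))
    ≡⟨ sum-cong (λ j → trans (cong (- sgn j * A zero (suc j) *_) (det-col₀ (minor zero (suc j) A)))
         (sym (sum-*ˡ (- sgn j * A zero (suc j)) (colTerm j)))) ⟩
  sumℚ (λ j → sumℚ (λ i → - sgn j * A zero (suc j) * colTerm j i))
    ≡⟨ sum-swap (λ j i → - sgn j * A zero (suc j) * colTerm j i) ⟩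
  sumℚ (λ i → sumℚ (λ j → - sgn j * A zero (suc j) * colTerm j i))
    ≡⟨ sum-cong (λ i → trans (sum-cong λ j →
         solve 5 (λ j i a b D → (:- j) :* a :* (i :* b :* D) := (:- i) :* b :* (j :* a :* D)) refl
           (sgn j) (sgn i) (A zero (suc j)) (A (suc i) zero) (det (minor zero j (minor (suc i) zero A))))
         (sum-*ˡ (- sgn i * A (suc i) zero) (λ j → sgn j * A zero (suc j) * det (minor zero j (minor (suc i) zero A))))) ⟩
  sumℚ (λ i → - sgn i * A (suc i) zero * det (minor (suc i) zero A)) ∎)
  where
  colTerm : Fin (suc n) → Fin (suc n) → ℚ
  colTerm j i = sgn i * A (suc i) zero * det (minor i zero (minor zero (suc j) A))

_ᵀ : ∀ {n} → Matrix n → Matrix n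
(A ᵀ) r c = A c r

det-ᵀ : ∀ {n} (A : Matrix n) → det (A ᵀ) ≡ det A
det-ᵀ {zero}  A = refl
det-ᵀ {suc n} A = trans (det-col₀ (A ᵀ))
  (sum-cong λ j → cong (sgn j * A zero j *_) (det-ᵀ (minor zero j A)))

-- The sum is the expansion along row `i` of the matrix whose row `i` is overwritten by row `k`, and
-- that matrix has two equal rows.
alien-cofactors : ∀ {n} (A : Matrix (suc n)) {i k} → i ≢ k →
  sumℚ (λ j → sgn i * sgn j * A k j * det (minor i j A)) ≡ 0ℚ
alien-cofactors A {i} {k} i≢k = begin
  sumℚ (λ j → sgn i * sgn j * A k j * det (minor i j A))
    ≡⟨ sum-cong (λ j → cong₂ (λ x y → sgn i * sgn j * x * y)
         (sym (cong-app (updateAt-updates i {const (A k)} A) j))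
         (det-cong λ r c → cong-app (sym (updateAt-minimal (punchIn i r) i {const (A k)} A (Fin.punchInᵢ≢i i r))) (punchIn j c))) ⟩
  sumℚ (rowTerm A′ i)
    ≡⟨ det-row A′ i ⟨
  det A′
    ≡⟨ det-equal-rows A′ i≢k (λ c → trans (cong-app (updateAt-updates i {const (A k)} A) c) (sym (cong-app (updateAt-minimal k i {const (A k)} A (i≢k ∘ sym)) c))) ⟩
  0ℚ ∎
  where
  A′ = updateAt A i (const (A k))

det-row-add : ∀ {n} (A B : Matrix n) i (t : Fin n → ℚ) → t i ≡ 0ℚ →
  (∀ r → r ≢ i → ∀ c → B r c ≡ A r c) → (∀ c → B i c ≡ A i c + sumℚ (λ k → t k * A k c)) →
  det B ≡ det A
det-row-add {suc n} A B i t tᵢ≡0 other this = begin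
  det B
    ≡⟨ det-row B i ⟩
  sumℚ (rowTerm B i)
    ≡⟨ sum-cong expand ⟩
  sumℚ (λ j → rowTerm A i j + sumℚ (λ k → t k * foreign k j))
    ≡⟨ sum-+ (rowTerm A i) (λ j → sumℚ (λ k → t k * foreign k j)) ⟩
  sumℚ (rowTerm A i) + sumℚ (λ j → sumℚ (λ k → t k * foreign k j))
    ≡⟨ cong₂ _+_ (sym (det-row A i)) (sum-swap (λ j k → t k * foreign k j)) ⟩
  det A + sumℚ (λ k → sumℚ (λ j → t k * foreign k j))
    ≡⟨ cong (det A +_) (sum-≡0 (λ k → trans (sum-*ˡ (t k) (foreign k)) (vanish k))) ⟩
  det A + 0ℚ
    ≡⟨ ℚ.+-identityʳ _ ⟩
  det A ∎
  where
  foreign : Fin (suc n) → Fin (suc n) → ℚ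
  foreign k j = sgn i * sgn j * A k j * det (minor i j A)
  vanish : ∀ k → t k * sumℚ (foreign k) ≡ 0ℚ
  vanish k with i ≟ k
  ... | yes refl = trans (cong (_* sumℚ (foreign i)) tᵢ≡0) (ℚ.*-zeroˡ (sumℚ (foreign i)))
  ... | no i≢k   = trans (cong (t k *_) (alien-cofactors A i≢k)) (ℚ.*-zeroʳ (t k))
  expand : ∀ j → rowTerm B i j ≡ rowTerm A i j + sumℚ (λ k → t k * foreign k j)
  expand j = begin
    rowTerm B i j
      ≡⟨ cong₂ (λ x y → sgn i * sgn j * x * y) (this j) (det-cong λ r c → other (punchIn i r) (Fin.punchInᵢ≢i i r) (punchIn j c)) ⟩
    s * (A i j + X) * D
      ≡⟨ solve 4 (λ s a x d → s :* (a :+ x) :* d := s :* a :* d :+ x :* (s :* d)) refl s (A i j) X D ⟩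
    rowTerm A i j + X * (s * D)
      ≡⟨ cong (rowTerm A i j +_) (trans (sym (sum-*ʳ (s * D) (λ k → t k * A k j)))
           (sum-cong λ k → solve 4 (λ t a s d → t :* a :* (s :* d) := t :* (s :* a :* d)) refl (t k) (A k j) s D)) ⟩
    rowTerm A i j + sumℚ (λ k → t k * foreign k j) ∎
    where
    s = sgn i * sgn j
    X = sumℚ (λ k → t k * A k j)
    D = det (minor i j A)

-- The rows are changed one at a time; a row that is used is never changed.
det-row-ops : ∀ {n} (A B : Matrix n) (t : Fin n → Fin n → ℚ) → (∀ r → t r r ≡ 0ℚ) →
  (∀ r c → B r c ≡ A r c + sumℚ (λ k → t r k * A k c)) →
  (∀ r k → t r k ≡ 0ℚ ⊎ (∀ c → B k c ≡ A k c)) →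
  det B ≡ det A
det-row-ops {n} A B t tᵣᵣ≡0 ops fixed = begin
  det B          ≡⟨ det-cong (λ r c → cong-app (sym (hybrid-< (Fin.toℕ<n r))) c) ⟩
  det (hybrid n) ≡⟨ go n ℕ.≤-refl ⟩
  det A          ∎
  where
  hybrid : ℕ → Matrix n
  hybrid m r = if does (toℕ r ℕ.<? m) then B r else A r
  hybrid-< : ∀ {m r} → toℕ r ℕ.< m → hybrid m r ≡ B r
  hybrid-< {m} {r} r<m = cong (if_then B r else A r) (dec-true (toℕ r ℕ.<? m) r<m)
  hybrid-≮ : ∀ {m r} → ¬ toℕ r ℕ.< m → hybrid m r ≡ A r
  hybrid-≮ {m} {r} r≮m = cong (if_then B r else A r) (dec-false (toℕ r ℕ.<? m) r≮m)
  fixed-hybrid : ∀ m k → (∀ c → B k c ≡ A k c) → ∀ c → hybrid m k c ≡ A k c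
  fixed-hybrid m k h with does (toℕ k ℕ.<? m)
  ... | true  = h
  ... | false = λ _ → refl
  go : ∀ m → m ℕ.≤ n → det (hybrid m) ≡ det A
  go zero    _   = refl
  go (suc m) m<n = trans (det-row-add (hybrid m) (hybrid (suc m)) i (t i) (tᵣᵣ≡0 i) other this) (go m (ℕ.<⇒≤ m<n))
    where
    i = fromℕ< m<n
    toℕi≡m : toℕ i ≡ m
    toℕi≡m = Fin.toℕ-fromℕ< m<n
    other : ∀ r → r ≢ i → ∀ c → hybrid (suc m) r c ≡ hybrid m r c
    other r r≢i c = cong-app (by-cases (toℕ r ℕ.<? m)) c
      where
      by-cases : Dec (toℕ r ℕ.< m) → hybrid (suc m) r ≡ hybrid m r
      by-cases (yes r<m) = trans (hybrid-< (ℕ.m<n⇒m<1+n r<m)) (sym (hybrid-< r<m))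
      by-cases (no r≮m)  = trans (hybrid-≮ λ r<1+m → r≢i (Fin.toℕ-injective
        (trans (ℕ.≤-antisym (ℕ.≤-pred r<1+m) (ℕ.≮⇒≥ r≮m)) (sym toℕi≡m)))) (sym (hybrid-≮ r≮m))
    this : ∀ c → hybrid (suc m) i c ≡ hybrid m i c + sumℚ (λ k → t i k * hybrid m k c)
    this c = begin
      hybrid (suc m) i c
        ≡⟨ cong-app (hybrid-< (ℕ.≤-reflexive (cong suc toℕi≡m))) c ⟩
      B i c
        ≡⟨ ops i c ⟩
      A i c + sumℚ (λ k → t i k * A k c)
        ≡⟨ cong₂ _+_
             (cong-app (sym (hybrid-≮ (ℕ.<-irrefl toℕi≡m))) c)
             (sum-cong λ k → term k (fixed i k)) ⟩
      hybrid m i c + sumℚ (λ k → t i k * hybrid m k c) ∎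
      where
      term : ∀ k → t i k ≡ 0ℚ ⊎ (∀ c → B k c ≡ A k c) → t i k * A k c ≡ t i k * hybrid m k c
      term k (inj₁ z) = trans (cong (_* A k c) z) (trans (ℚ.*-zeroˡ (A k c)) (sym (trans (cong (_* hybrid m k c) z) (ℚ.*-zeroˡ (hybrid m k c)))))
      term k (inj₂ h) = cong (t i k *_) (sym (fixed-hybrid m k h c))

-- In the expansion along row `i` the minors do not see the changed entry.
det-add-entry : ∀ {n} (A : Matrix n) i j x →
  det (λ r c → A r c + x * (δ i r * δ j c)) ≡ det A + x * cofactor A i j
det-add-entry {suc n} A i j x = begin
  det A′
    ≡⟨ det-row A′ i ⟩
  sumℚ (rowTerm A′ i)
    ≡⟨ sum-cong (λ l → trans
         (cong₂ (λ e d → sgn i * sgn l * (A i l + x * (e * δ j l)) * d) (δ-refl i) (det-cong (same l)))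
         (solve 6 (λ si sl a x e d → si :* sl :* (a :+ x :* (con 1ℚ :* e)) :* d := si :* sl :* a :* d :+ x :* (e :* (si :* sl :* d))) refl
           (sgn i) (sgn l) (A i l) x (δ j l) (det (minor i l A)))) ⟩
  sumℚ (λ l → rowTerm A i l + x * (δ j l * cof l))
    ≡⟨ sum-+ (rowTerm A i) (λ l → x * (δ j l * cof l)) ⟩
  sumℚ (rowTerm A i) + sumℚ (λ l → x * (δ j l * cof l))
    ≡⟨ cong₂ _+_ (sym (det-row A i)) (trans (sum-*ˡ x (λ l → δ j l * cof l)) (cong (x *_) (sum-δ j cof))) ⟩
  det A + x * (sgn i * sgn j * det (minor i j A))
    ≡⟨ cong (λ s → det A + x * (s * det (minor i j A))) (sym (sign-+ (toℕ i) (toℕ j))) ⟩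
  det A + x * cofactor A i j ∎
  where
  cof : Fin (suc n) → ℚ
  cof l = sgn i * sgn l * det (minor i l A)
  A′ : Matrix (suc n)
  A′ r c = A r c + x * (δ i r * δ j c)
  same : ∀ l r c → minor i l A′ r c ≡ minor i l A r c
  same l r c = begin
    minor i l A r c + x * (δ i (punchIn i r) * δ j (punchIn l c))
      ≡⟨ cong (λ e → minor i l A r c + x * (e * δ j (punchIn l c))) (δ-≢ (Fin.punchInᵢ≢i i r ∘ sym)) ⟩
    minor i l A r c + x * (0ℚ * δ j (punchIn l c))
      ≡⟨ solve 3 (λ a x d → a :+ x :* (con 0ℚ :* d) := a) refl (minor i l A r c) x (δ j (punchIn l c)) ⟩
    minor i l A r c ∎

det-zero-col : ∀ {m} (A : Matrix m) j → (∀ r → A r j ≡ 0ℚ) → det A ≡ 0ℚ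
det-zero-col {suc m} A j h = begin
  det A
    ≡⟨ det-ᵀ A ⟨
  det (A ᵀ)
    ≡⟨ det-row (A ᵀ) j ⟩
  sumℚ (rowTerm (A ᵀ) j)
    ≡⟨ sum-≡0 (λ r → trans (cong (λ x → sgn j * sgn r * x * det (minor j r (A ᵀ))) (h r))
         (solve 2 (λ s D → s :* con 0ℚ :* D := con 0ℚ) refl (sgn j * sgn r) (det (minor j r (A ᵀ))))) ⟩
  0ℚ ∎

-- Determinants of block matrices

splitAt-punchIn : ∀ {c} s (j : Fin (suc c)) (q : Fin (c ℕ.+ s)) →
  splitAt (suc c) (punchIn (j ↑ˡ s) q) ≡ Sum.map (punchIn j) id (splitAt c q)
splitAt-punchIn         s zero    q       = refl
splitAt-punchIn {suc c} s (suc j) zero    = refl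
splitAt-punchIn {suc c} s (suc j) (suc q) = begin
  Sum.map suc id (splitAt (suc c) (punchIn (j ↑ˡ s) q))            ≡⟨ cong (Sum.map suc id) (splitAt-punchIn s j q) ⟩
  Sum.map suc id (Sum.map (punchIn j) id (splitAt c q))            ≡⟨ shift (splitAt c q) ⟩
  Sum.map (punchIn (suc j)) id (Sum.map suc id (splitAt c q))      ∎
  where
  shift : (z : Fin c ⊎ Fin s) → Sum.map suc id (Sum.map (punchIn j) id z) ≡ Sum.map (punchIn (suc j)) id (Sum.map suc id z)
  shift (inj₁ _) = refl
  shift (inj₂ _) = refl

-- The block matrix [[Y , A] , [B , X]]. Indexing by a sum type lets pattern matching select the
-- block; `join⊎` carries it to `Fin (c + s)`, where `det` is defined.
quad : ∀ {c s} → Matrix c → (Fin c → Fin s → ℚ) → (Fin s → Fin c → ℚ) → Matrix s →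
  Fin c ⊎ Fin s → Fin c ⊎ Fin s → ℚ
quad Y A B X (inj₁ p) (inj₁ q) = Y p q
quad Y A B X (inj₁ p) (inj₂ l) = A p l
quad Y A B X (inj₂ k) (inj₁ q) = B k q
quad Y A B X (inj₂ k) (inj₂ l) = X k l

join⊎ : ∀ {c s} → (Fin c ⊎ Fin s → Fin c ⊎ Fin s → ℚ) → Matrix (c ℕ.+ s)
join⊎ {c} K r q = K (splitAt c r) (splitAt c q)

𝟘 : ∀ {c s} → Fin c → Fin s → ℚ
𝟘 _ _ = 0ℚ

-- Induction on `c`, expanding along row zero: the columns of the right block contribute zero, and
-- deleting a column of the left block keeps the block shape.
det-lower : ∀ {c s} (Y : Matrix c) (B : Fin s → Fin c → ℚ) (X : Matrix s) →
  det (join⊎ (quad Y 𝟘 B X)) ≡ det Y * det X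
det-lower {zero}  Y B X = sym (ℚ.*-identityˡ (det X))
det-lower {suc c} {s} Y B X = begin
  det K
    ≡⟨ sum-↑ (suc c) (λ j → sgn j * K zero j * det (minor zero j K)) ⟩
  sumℚ (λ j → sgn (j ↑ˡ s) * K zero (j ↑ˡ s) * det (minor zero (j ↑ˡ s) K)) + sumℚ right
    ≡⟨ cong₂ _+_ (sum-cong left) (sum-≡0 right≡0) ⟩
  sumℚ (λ j → sgn j * Y zero j * det (minor zero j Y) * det X) + 0ℚ
    ≡⟨ ℚ.+-identityʳ (sumℚ (λ j → sgn j * Y zero j * det (minor zero j Y) * det X)) ⟩
  sumℚ (λ j → sgn j * Y zero j * det (minor zero j Y) * det X)
    ≡⟨ sum-*ʳ (det X) (λ j → sgn j * Y zero j * det (minor zero j Y)) ⟩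
  det Y * det X ∎
  where
  K = join⊎ (quad Y 𝟘 B X)
  right : Fin s → ℚ
  right k = sgn (suc c ↑ʳ k) * K zero (suc c ↑ʳ k) * det (minor zero (suc c ↑ʳ k) K)
  right≡0 : ∀ k → right k ≡ 0ℚ
  right≡0 k = begin
    right k
      ≡⟨ cong (λ z → σ * quad Y 𝟘 B X (inj₁ zero) z * D) (Fin.splitAt-↑ʳ (suc c) s k) ⟩
    σ * 0ℚ * D
      ≡⟨ solve 2 (λ σ D → σ :* con 0ℚ :* D := con 0ℚ) refl σ D ⟩
    0ℚ ∎
    where
    σ = sgn (suc c ↑ʳ k)
    D = det (minor zero (suc c ↑ʳ k) K)
  minor-quad : ∀ j z w → quad Y 𝟘 B X (Sum.map suc id z) (Sum.map (punchIn j) id w) ≡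
    quad (minor zero j Y) 𝟘 (λ k q → B k (punchIn j q)) X z w
  minor-quad j (inj₁ _) (inj₁ _) = refl
  minor-quad j (inj₁ _) (inj₂ _) = refl
  minor-quad j (inj₂ _) (inj₁ _) = refl
  minor-quad j (inj₂ _) (inj₂ _) = refl
  left : ∀ j → sgn (j ↑ˡ s) * K zero (j ↑ˡ s) * det (minor zero (j ↑ˡ s) K) ≡ sgn j * Y zero j * det (minor zero j Y) * det X
  left j = begin
    sgn (j ↑ˡ s) * K zero (j ↑ˡ s) * det (minor zero (j ↑ˡ s) K)
      ≡⟨ cong₂ _*_ (cong₂ (λ t z → sign t * quad Y 𝟘 B X (inj₁ zero) z) (Fin.toℕ-↑ˡ j s) (Fin.splitAt-↑ˡ (suc c) j s))
           (trans (det-cong λ r q → trans (cong (quad Y 𝟘 B X (Sum.map suc id (splitAt c r))) (splitAt-punchIn s j q))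
                                          (minor-quad j (splitAt c r) (splitAt c q)))
                  (det-lower (minor zero j Y) (λ k q → B k (punchIn j q)) X)) ⟩
    sgn j * Y zero j * (det (minor zero j Y) * det X)
      ≡⟨ ℚ.*-assoc (sgn j * Y zero j) (det (minor zero j Y)) (det X) ⟨
    sgn j * Y zero j * det (minor zero j Y) * det X ∎

det-upper : ∀ {c s} (Y : Matrix c) (A : Fin c → Fin s → ℚ) (X : Matrix s) →
  det (join⊎ (quad Y A 𝟘 X)) ≡ det Y * det X
det-upper {c} Y A X = begin
  det (join⊎ (quad Y A 𝟘 X))
    ≡⟨ det-ᵀ (join⊎ (quad Y A 𝟘 X)) ⟨
  det (join⊎ (quad Y A 𝟘 X) ᵀ)
    ≡⟨ det-cong (λ r q → transposed (splitAt c r) (splitAt c q)) ⟩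
  det (join⊎ (quad (Y ᵀ) 𝟘 (λ k p → A p k) (X ᵀ)))
    ≡⟨ det-lower (Y ᵀ) (λ k p → A p k) (X ᵀ) ⟩
  det (Y ᵀ) * det (X ᵀ)
    ≡⟨ cong₂ _*_ (det-ᵀ Y) (det-ᵀ X) ⟩
  det Y * det X ∎
  where
  transposed : ∀ z w → quad Y A 𝟘 X w z ≡ quad (Y ᵀ) 𝟘 (λ k p → A p k) (X ᵀ) z w
  transposed (inj₁ _) (inj₁ _) = refl
  transposed (inj₁ _) (inj₂ _) = refl
  transposed (inj₂ _) (inj₁ _) = refl
  transposed (inj₂ _) (inj₂ _) = refl

det-ops⊎ : ∀ {c s} (K K′ t : Fin c ⊎ Fin s → Fin c ⊎ Fin s → ℚ) → (∀ z → t z z ≡ 0ℚ) →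
  (∀ z w → K′ z w ≡ K z w + (sumℚ (λ p → t z (inj₁ p) * K (inj₁ p) w) + sumℚ (λ k → t z (inj₂ k) * K (inj₂ k) w))) →
  (∀ z y → t z y ≡ 0ℚ ⊎ (∀ w → K′ y w ≡ K y w)) →
  det (join⊎ K′) ≡ det (join⊎ K)
det-ops⊎ {c} K K′ t t≡0 ops fixed = det-row-ops (join⊎ K) (join⊎ K′) (join⊎ t)
  (λ r → t≡0 (splitAt c r))
  (λ r q → trans (ops (splitAt c r) (splitAt c q))
    (cong (K (splitAt c r) (splitAt c q) +_) (sym (sum-splitAt c (λ z → t (splitAt c r) z * K z (splitAt c q))))))
  (λ r k → Sum.map₂ (λ h q → h (splitAt c q)) (fixed (splitAt c r) (splitAt c k)))

-- Block elimination: `T` times the upper block row is added to the lower one. The rows that are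
-- used are the upper ones, and these stay fixed, as `det-row-ops` requires.
det-lower-ops : ∀ {c s} (Y : Matrix c) (A : Fin c → Fin s → ℚ) (B B′ : Fin s → Fin c → ℚ) (X X′ : Matrix s) (T : Fin s → Fin c → ℚ) →
  (∀ k q → B′ k q ≡ B k q + sumℚ (λ p → T k p * Y p q)) →
  (∀ k l → X′ k l ≡ X k l + sumℚ (λ p → T k p * A p l)) →
  det (join⊎ (quad Y A B′ X′)) ≡ det (join⊎ (quad Y A B X))
det-lower-ops {c} {s} Y A B B′ X X′ T opB opX =
  det-ops⊎ (quad Y A B X) (quad Y A B′ X′) (quad 𝟘 𝟘 T 𝟘) diagonal ops fixed
  where
  diagonal : ∀ z → quad 𝟘 𝟘 T 𝟘 z z ≡ 0ℚ
  diagonal (inj₁ _) = refl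
  diagonal (inj₂ _) = refl
  noop : ∀ x (f : Fin c → ℚ) (g : Fin s → ℚ) → x ≡ x + (sumℚ (λ p → 0ℚ * f p) + sumℚ (λ k → 0ℚ * g k))
  noop x f g = sym (trans (cong (x +_) (cong₂ _+_ (sum-0* f) (sum-0* g))) (ℚ.+-identityʳ x))
  op : ∀ {x} y z (g : Fin s → ℚ) → x ≡ y + z → x ≡ y + (z + sumℚ (λ k → 0ℚ * g k))
  op y z g eq = trans eq (cong (y +_) (sym (trans (cong (z +_) (sum-0* g)) (ℚ.+-identityʳ z))))
  ops : ∀ z w → quad Y A B′ X′ z w ≡ quad Y A B X z w +
    (sumℚ (λ p → quad 𝟘 𝟘 T 𝟘 z (inj₁ p) * quad Y A B X (inj₁ p) w) + sumℚ (λ k → quad 𝟘 𝟘 T 𝟘 z (inj₂ k) * quad Y A B X (inj₂ k) w))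
  ops (inj₁ p) (inj₁ q) = noop (Y p q) (λ p → Y p q) (λ k → B k q)
  ops (inj₁ p) (inj₂ l) = noop (A p l) (λ p → A p l) (λ k → X k l)
  ops (inj₂ k) (inj₁ q) = op (B k q) (sumℚ (λ p → T k p * Y p q)) (λ k → B k q) (opB k q)
  ops (inj₂ k) (inj₂ l) = op (X k l) (sumℚ (λ p → T k p * A p l)) (λ k → X k l) (opX k l)
  fixed : ∀ z y → quad 𝟘 𝟘 T 𝟘 z y ≡ 0ℚ ⊎ (∀ w → quad Y A B′ X′ y w ≡ quad Y A B X y w)
  fixed z        (inj₁ _) = inj₂ λ { (inj₁ _) → refl ; (inj₂ _) → refl }
  fixed (inj₁ _) (inj₂ _) = inj₁ refl
  fixed (inj₂ _) (inj₂ _) = inj₁ refl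

det-upper-ops : ∀ {c s} (Y Y′ : Matrix c) (A A′ : Fin c → Fin s → ℚ) (B : Fin s → Fin c → ℚ) (X : Matrix s) (T : Fin c → Fin s → ℚ) →
  (∀ p q → Y′ p q ≡ Y p q + sumℚ (λ k → T p k * B k q)) →
  (∀ p l → A′ p l ≡ A p l + sumℚ (λ k → T p k * X k l)) →
  det (join⊎ (quad Y′ A′ B X)) ≡ det (join⊎ (quad Y A B X))
det-upper-ops {c} {s} Y Y′ A A′ B X T opY opA =
  det-ops⊎ (quad Y A B X) (quad Y′ A′ B X) (quad 𝟘 T 𝟘 𝟘) diagonal ops fixed
  where
  diagonal : ∀ z → quad 𝟘 T 𝟘 𝟘 z z ≡ 0ℚ
  diagonal (inj₁ _) = refl
  diagonal (inj₂ _) = refl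
  noop : ∀ x (f : Fin c → ℚ) (g : Fin s → ℚ) → x ≡ x + (sumℚ (λ p → 0ℚ * f p) + sumℚ (λ k → 0ℚ * g k))
  noop x f g = sym (trans (cong (x +_) (cong₂ _+_ (sum-0* f) (sum-0* g))) (ℚ.+-identityʳ x))
  op : ∀ {x} y z (f : Fin c → ℚ) → x ≡ y + z → x ≡ y + (sumℚ (λ p → 0ℚ * f p) + z)
  op y z f eq = trans eq (cong (y +_) (sym (trans (cong (_+ z) (sum-0* f)) (ℚ.+-identityˡ z))))
  ops : ∀ z w → quad Y′ A′ B X z w ≡ quad Y A B X z w +
    (sumℚ (λ p → quad 𝟘 T 𝟘 𝟘 z (inj₁ p) * quad Y A B X (inj₁ p) w) + sumℚ (λ k → quad 𝟘 T 𝟘 𝟘 z (inj₂ k) * quad Y A B X (inj₂ k) w))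
  ops (inj₁ p) (inj₁ q) = op (Y p q) (sumℚ (λ k → T p k * B k q)) (λ p → Y p q) (opY p q)
  ops (inj₁ p) (inj₂ l) = op (A p l) (sumℚ (λ k → T p k * X k l)) (λ p → A p l) (opA p l)
  ops (inj₂ k) (inj₁ q) = noop (B k q) (λ p → Y p q) (λ k → B k q)
  ops (inj₂ k) (inj₂ l) = noop (X k l) (λ p → A p l) (λ k → X k l)
  fixed : ∀ z y → quad 𝟘 T 𝟘 𝟘 z y ≡ 0ℚ ⊎ (∀ w → quad Y′ A′ B X y w ≡ quad Y A B X y w)
  fixed z        (inj₂ _) = inj₂ λ { (inj₁ _) → refl ; (inj₂ _) → refl }
  fixed (inj₁ _) (inj₁ _) = inj₁ refl
  fixed (inj₂ _) (inj₁ _) = inj₁ refl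

diag : ∀ {n} → (Fin n → ℚ) → Matrix n
diag d p q = δ p q * d p

det-diag : ∀ {n} (d : Fin n → ℚ) → det (diag d) ≡ prodℚ d
det-diag {zero}  d = refl
det-diag {suc n} d = begin
  1ℚ * (1ℚ * d zero) * det (minor zero zero (diag d)) + sumℚ (λ j → sgn (suc j) * (0ℚ * d zero) * det (minor zero (suc j) (diag d)))
    ≡⟨ cong₂ _+_
         (cong₂ _*_ (trans (ℚ.*-identityˡ (1ℚ * d zero)) (ℚ.*-identityˡ (d zero)))
                    (trans (det-cong λ p q → cong (_* d (suc p)) (δ-suc p q)) (det-diag (d ∘ suc))))
         (sum-≡0 λ j → solve 3 (λ s d D → s :* (con 0ℚ :* d) :* D := con 0ℚ) refl (sgn (suc j)) (d zero) (det (minor zero (suc j) (diag d)))) ⟩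
  d zero * prodℚ (d ∘ suc) + 0ℚ
    ≡⟨ ℚ.+-identityʳ (d zero * prodℚ (d ∘ suc)) ⟩
  prodℚ d ∎

prod-one : ∀ n → prodℚ {n} (λ _ → 1ℚ) ≡ 1ℚ
prod-one zero    = refl
prod-one (suc n) = cong (1ℚ *_) (prod-one n)

det-δ : ∀ {n} → det {n} δ ≡ 1ℚ
det-δ {n} = trans (det-cong {n} λ p q → sym (ℚ.*-identityʳ (δ p q))) (trans (det-diag {n} (λ _ → 1ℚ)) (prod-one n))

-- Both sides are the determinant of [[diag d , A] , [B , 1]], eliminated from either diagonal block.
weinstein-aronszajn : ∀ {c s} (d e : Fin c → ℚ) → (∀ p → d p * e p ≡ 1ℚ) →
  (A : Fin c → Fin s → ℚ) (B : Fin s → Fin c → ℚ) →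
  prodℚ d * det (λ k l → δ k l - sumℚ (λ p → B k p * e p * A p l)) ≡
  det (λ p q → diag d p q - sumℚ (λ k → A p k * B k q))
weinstein-aronszajn {c} {s} d e de≡1 A B = begin
  prodℚ d * det X
    ≡⟨ cong (_* det X) (det-diag d) ⟨
  det (diag d) * det X
    ≡⟨ det-upper (diag d) A X ⟨
  det (join⊎ (quad (diag d) A 𝟘 X))
    -- The multiplier is minus `B` times the inverse of `diag d`; it clears `B` and leaves the Schur
    -- complement `X` in the lower corner.
    ≡⟨ det-lower-ops (diag d) A B 𝟘 δ X (λ k p → - (B k p * e p)) clearB
         (λ k l → cong (δ k l +_) (neg-sum (λ p → B k p * e p) (λ p → A p l))) ⟩
  det (join⊎ (quad (diag d) A B δ))
    -- Here the identity block clears `A` and leaves the Schur complement `Y` in the upper corner.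
    ≡⟨ det-upper-ops (diag d) Y A 𝟘 B δ (λ p k → - A p k)
         (λ p q → cong (diag d p q +_) (neg-sum (A p) (λ k → B k q))) clearA ⟨
  det (join⊎ (quad Y 𝟘 B δ))
    ≡⟨ det-lower Y B (δ {s}) ⟩
  det Y * det (δ {s})
    ≡⟨ trans (cong (det Y *_) (det-δ {s})) (ℚ.*-identityʳ (det Y)) ⟩
  det Y ∎
  where
  X : Matrix s
  X k l = δ k l - sumℚ (λ p → B k p * e p * A p l)
  Y : Matrix c
  Y p q = diag d p q - sumℚ (λ k → A p k * B k q)
  neg-sum : ∀ {n} (f g : Fin n → ℚ) → - sumℚ (λ i → f i * g i) ≡ sumℚ (λ i → - f i * g i)
  neg-sum f g = trans (sym (sum-neg (λ i → f i * g i))) (sum-cong λ i → ℚ.neg-distribˡ-* (f i) (g i))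
  clearA : ∀ p l → 0ℚ ≡ A p l + sumℚ (λ k → - A p k * δ k l)
  clearA p l = sym (begin
    A p l + sumℚ (λ k → - A p k * δ k l)
      ≡⟨ cong (A p l +_) (trans (sum-cong λ k → trans (cong (- A p k *_) (δ-sym k l)) (ℚ.*-comm (- A p k) (δ l k))) (sum-δ l (λ k → - A p k))) ⟩
    A p l - A p l
      ≡⟨ ℚ.+-inverseʳ (A p l) ⟩
    0ℚ ∎)
  clearB : ∀ k q → 0ℚ ≡ B k q + sumℚ (λ p → - (B k p * e p) * (δ p q * d p))
  clearB k q = sym (begin
    B k q + sumℚ (λ p → - (B k p * e p) * (δ p q * d p))
      ≡⟨ cong (B k q +_) (trans (sum-cong λ p → trans
           (cong (λ x → - (B k p * e p) * (x * d p)) (δ-sym p q))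
           (solve 4 (λ b e x d → (:- (b :* e)) :* (x :* d) := x :* (:- (b :* (d :* e)))) refl (B k p) (e p) (δ q p) (d p)))
           (sum-δ q (λ p → - (B k p * (d p * e p))))) ⟩
    B k q - B k q * (d q * e q)
      ≡⟨ cong (λ x → B k q - B k q * x) (de≡1 q) ⟩
    B k q - B k q * 1ℚ
      ≡⟨ solve 1 (λ b → b :- b :* con 1ℚ := con 0ℚ) refl (B k q) ⟩
    0ℚ ∎)

-- Identifying the indices p and q of a bilinear form.

addRow : ∀ {n} → Fin n → Fin n → Matrix n → Matrix n
addRow p q A a b = A a b + δ p a * A q b

det-addRow : ∀ {n} {p q : Fin n} → p ≢ q → (A : Matrix n) → det (addRow p q A) ≡ det A
det-addRow {p = p} {q} p≢q A = det-row-add A (addRow p q A) p (δ q) (δ-≢ (p≢q ∘ sym))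
  (λ r r≢p c → trans (cong (λ x → A r c + x * A q c) (δ-≢ (r≢p ∘ sym)))
                     (solve 2 (λ x y → x :+ con 0ℚ :* y := x) refl (A r c) (A q c)))
  (λ c → cong (A p c +_) (trans (trans (cong (_* A q c) (δ-refl p)) (ℚ.*-identityˡ (A q c)))
                                (sym (sum-δ q (λ k → A k c)))))

-- The congruence P A Pᵀ with P = 1 + e_p e_qᵀ. It sends the vector e_p - e_q to -e_q, so the
-- rank-one term of an edge becomes a single diagonal entry.
addRowCol : ∀ {n} → Fin n → Fin n → Matrix n → Matrix n
addRowCol p q A = addRow p q (addRow p q A ᵀ) ᵀ

det-addRowCol : ∀ {n} {p q : Fin n} → p ≢ q → (A : Matrix n) → det (addRowCol p q A) ≡ det A
det-addRowCol {p = p} {q} p≢q A = begin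
  det (addRowCol p q A)             ≡⟨ det-ᵀ (addRow p q (addRow p q A ᵀ)) ⟩
  det (addRow p q (addRow p q A ᵀ)) ≡⟨ det-addRow p≢q (addRow p q A ᵀ) ⟩
  det (addRow p q A ᵀ)              ≡⟨ det-ᵀ (addRow p q A) ⟩
  det (addRow p q A)                ≡⟨ det-addRow p≢q A ⟩
  det A                             ∎

contract : ∀ {n} → Fin (suc n) → Fin (suc n) → Matrix (suc n) → Matrix n
contract p q A = minor q q (addRowCol p q A)

edgeVector : ∀ {n} → Fin n → Fin n → Fin n → ℚ
edgeVector p q a = δ p a - δ q a

-- After the congruence of `addRowCol` the edge term is a 1 in position (q , q). Its coefficient in
-- the determinant is the minor at that position, and this minor is the contracted matrix.
det-deletion-contraction : ∀ {n} {p q : Fin (suc n)} → p ≢ q → (A : Matrix (suc n)) →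
  det (λ a b → A a b + edgeVector p q a * edgeVector p q b) ≡ det A + det (contract p q A)
det-deletion-contraction {n} {p} {q} p≢q A = begin
  det A⁺
    ≡⟨ det-addRowCol p≢q A⁺ ⟨
  det (addRowCol p q A⁺)
    ≡⟨ det-cong entry ⟩
  det (λ a b → A♯ a b + 1ℚ * (δ q a * δ q b))
    ≡⟨ det-add-entry A♯ q q 1ℚ ⟩
  det A♯ + 1ℚ * (sign (toℕ q ℕ.+ toℕ q) * det (contract p q A))
    ≡⟨ cong₂ (λ x s → x + 1ℚ * (s * det (contract p q A))) (det-addRowCol p≢q A)
         (trans (sign-+ (toℕ q) (toℕ q)) (sign-square (toℕ q))) ⟩
  det A + 1ℚ * (1ℚ * det (contract p q A))
    ≡⟨ solve 2 (λ x y → x :+ con 1ℚ :* (con 1ℚ :* y) := x :+ y) refl (det A) (det (contract p q A)) ⟩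
  det A + det (contract p q A) ∎
  where
  A⁺ A♯ : Matrix (suc n)
  A⁺ a b = A a b + edgeVector p q a * edgeVector p q b
  A♯ = addRowCol p q A
  entry : ∀ a b → addRowCol p q A⁺ a b ≡ A♯ a b + 1ℚ * (δ q a * δ q b)
  entry a b = begin
    addRowCol p q A⁺ a b
      ≡⟨ cong₂ (λ x y → A a b + (δ p a - δ q a) * (δ p b - δ q b) + δ p a * (A q b + (x - y) * (δ p b - δ q b)) +
                        δ p b * (A a q + (δ p a - δ q a) * (x - y) + δ p a * (A q q + (x - y) * (x - y))))
           (δ-≢ p≢q) (δ-refl q) ⟩
    _ ≡⟨ solve 8 (λ ab aq qb qq pa pb qa qb′ →
           ab :+ (pa :- qa) :* (pb :- qb′) :+ pa :* (qb :+ (con 0ℚ :- con 1ℚ) :* (pb :- qb′)) :+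
             pb :* (aq :+ (pa :- qa) :* (con 0ℚ :- con 1ℚ) :+ pa :* (qq :+ (con 0ℚ :- con 1ℚ) :* (con 0ℚ :- con 1ℚ)))
           := ab :+ pa :* qb :+ pb :* (aq :+ pa :* qq) :+ con 1ℚ :* (qa :* qb′)) refl
           (A a b) (A a q) (A q b) (A q q) (δ p a) (δ p b) (δ q a) (δ q b) ⟩
    A♯ a b + 1ℚ * (δ q a * δ q b) ∎

-- Merging two component labels

-- Label `q` is renamed to `p` and the gap is closed: a left inverse of `punchIn q` that sends `q`
-- where `p` goes.
merge : ∀ {c} {p q : Fin (suc c)} → p ≢ q → Fin (suc c) → Fin c
merge {q = q} p≢q r with q ≟ r
... | yes _  = punchOut (p≢q ∘ sym)
... | no q≢r = punchOut q≢r

merge-punchIn : ∀ {c} {p q : Fin (suc c)} (p≢q : p ≢ q) a → merge p≢q (punchIn q a) ≡ a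
merge-punchIn {q = q} p≢q a with q ≟ punchIn q a
... | yes eq = contradiction (sym eq) (Fin.punchInᵢ≢i q a)
... | no neq = trans (Fin.punchOut-cong q refl) (Fin.punchOut-punchIn q)

punchIn-merge : ∀ {c} {p q : Fin (suc c)} (p≢q : p ≢ q) r →
  (r ≢ q × punchIn q (merge p≢q r) ≡ r) ⊎ (r ≡ q × punchIn q (merge p≢q r) ≡ p)
punchIn-merge {q = q} p≢q r with q ≟ r
... | yes q≡r = inj₂ (sym q≡r , Fin.punchIn-punchOut (p≢q ∘ sym))
... | no q≢r  = inj₁ (q≢r ∘ sym , Fin.punchIn-punchOut q≢r)

merge-identifies : ∀ {c} {p q : Fin (suc c)} (p≢q : p ≢ q) → merge p≢q p ≡ merge p≢q q
merge-identifies {p = p} {q} p≢q with punchIn-merge p≢q p | punchIn-merge p≢q q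
... | inj₂ (p≡q , _) | _              = contradiction p≡q p≢q
... | inj₁ _         | inj₁ (q≢q , _) = contradiction refl q≢q
... | inj₁ (_ , ep)  | inj₂ (_ , eq)  = Fin.punchIn-injective q _ _ (trans ep (sym eq))

merge-≡ : ∀ {c} {p q : Fin (suc c)} (p≢q : p ≢ q) {r r′} → merge p≢q r ≡ merge p≢q r′ →
  r ≡ r′ ⊎ (r ≡ p × r′ ≡ q) ⊎ (r ≡ q × r′ ≡ p)
merge-≡ {q = q} p≢q {r} {r′} eq with punchIn-merge p≢q r | punchIn-merge p≢q r′
... | inj₁ (_ , e) | inj₁ (_ , e′)    = inj₁ (trans (sym e) (trans (cong (punchIn q) eq) e′))
... | inj₁ (_ , e) | inj₂ (r′≡q , e′) = inj₂ (inj₁ (trans (sym e) (trans (cong (punchIn q) eq) e′) , r′≡q))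
... | inj₂ (r≡q , e) | inj₁ (_ , e′)  = inj₂ (inj₂ (r≡q , trans (sym e′) (trans (cong (punchIn q) (sym eq)) e)))
... | inj₂ (r≡q , _) | inj₂ (r′≡q , _) = inj₁ (trans r≡q (sym r′≡q))

-- Coordinate `q` of an indicator vector is added to coordinate `p` and then dropped, which is what
-- `contract` does to rows and columns.
δ-merge : ∀ {c} {p q : Fin (suc c)} (p≢q : p ≢ q) r a →
  δ (merge p≢q r) a ≡ δ r (punchIn q a) + δ p (punchIn q a) * δ r q
δ-merge {p = p} {q} p≢q r a with punchIn-merge p≢q r
... | inj₁ (r≢q , e) = begin
  δ (merge p≢q r) a
    ≡⟨ δ-cong (λ eq → trans (sym e) (cong (punchIn q) eq)) (λ eq → Fin.punchIn-injective q _ _ (trans e eq)) ⟩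
  δ r (punchIn q a)
    ≡⟨ solve 2 (λ x y → x := x :+ y :* con 0ℚ) refl (δ r (punchIn q a)) (δ p (punchIn q a)) ⟩
  δ r (punchIn q a) + δ p (punchIn q a) * 0ℚ
    ≡⟨ cong (λ x → δ r (punchIn q a) + δ p (punchIn q a) * x) (δ-≢ r≢q) ⟨
  δ r (punchIn q a) + δ p (punchIn q a) * δ r q ∎
... | inj₂ (refl , e) = begin
  δ (merge p≢q r) a
    ≡⟨ δ-cong (λ eq → trans (sym e) (cong (punchIn q) eq)) (λ eq → Fin.punchIn-injective q _ _ (trans e eq)) ⟩
  δ p (punchIn q a)
    ≡⟨ solve 1 (λ y → y := con 0ℚ :+ y :* con 1ℚ) refl (δ p (punchIn q a)) ⟩
  0ℚ + δ p (punchIn q a) * 1ℚ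
    ≡⟨ cong₂ (λ x y → x + δ p (punchIn q a) * y) (δ-≢ (Fin.punchInᵢ≢i q a ∘ sym)) (δ-refl q) ⟨
  δ r (punchIn q a) + δ p (punchIn q a) * δ r q ∎

-- Index zero belongs to the border and is untouched by the merging; the labels sit one place
-- higher.
δ-suc-merge : ∀ {c} {p q : Fin (suc c)} (p≢q : p ≢ q) r a →
  δ (suc (merge p≢q r)) a ≡ δ (suc r) (punchIn (suc q) a) + δ (suc p) (punchIn (suc q) a) * δ (suc r) (suc q)
δ-suc-merge {q = q} p≢q r zero = sym (trans (ℚ.+-identityˡ (0ℚ * δ (suc r) (suc q))) (ℚ.*-zeroˡ (δ (suc r) (suc q))))
δ-suc-merge {p = p} {q} p≢q r (suc a) = begin
  δ (suc (merge p≢q r)) (suc a)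
    ≡⟨ δ-suc (merge p≢q r) a ⟩
  δ (merge p≢q r) a
    ≡⟨ δ-merge p≢q r a ⟩
  δ r (punchIn q a) + δ p (punchIn q a) * δ r q
    ≡⟨ cong₂ _+_ (δ-suc r (punchIn q a)) (cong₂ _*_ (δ-suc p (punchIn q a)) (δ-suc r q)) ⟨
  δ (suc r) (suc (punchIn q a)) + δ (suc p) (suc (punchIn q a)) * δ (suc r) (suc q) ∎

fin1-≡ : (p q : Fin 1) → p ≡ q
fin1-≡ zero zero = refl

-- The bordered Laplacian

Edges : ℕ → Set
Edges n = List (Fin n × Fin n)

fibreSum : ∀ {n c} → (Fin n → Fin c) → (Fin n → ℚ) → Fin c → ℚ
fibreSum comp w p = sumℚ (λ x → δ (comp x) p * w x)

fibreSum-merge : ∀ {n c} (comp : Fin n → Fin (suc c)) (w : Fin n → ℚ) {p q} (p≢q : p ≢ q) a →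
  fibreSum (merge p≢q ∘ comp) w a ≡ fibreSum comp w (punchIn q a) + δ p (punchIn q a) * fibreSum comp w q
fibreSum-merge comp w {p} {q} p≢q a = begin
  sumℚ (λ x → δ (merge p≢q (comp x)) a * w x)
    ≡⟨ sum-cong (λ x → trans (cong (_* w x) (δ-merge p≢q (comp x) a))
         (solve 4 (λ d e f w → (d :+ e :* f) :* w := d :* w :+ e :* (f :* w)) refl
           (δ (comp x) (punchIn q a)) (δ p (punchIn q a)) (δ (comp x) q) (w x))) ⟩
  sumℚ (λ x → δ (comp x) (punchIn q a) * w x + δ p (punchIn q a) * (δ (comp x) q * w x))
    ≡⟨ sum-+ (λ x → δ (comp x) (punchIn q a) * w x) (λ x → δ p (punchIn q a) * (δ (comp x) q * w x)) ⟩
  fibreSum comp w (punchIn q a) + sumℚ (λ x → δ p (punchIn q a) * (δ (comp x) q * w x))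
    ≡⟨ cong (fibreSum comp w (punchIn q a) +_) (sum-*ˡ (δ p (punchIn q a)) (λ x → δ (comp x) q * w x)) ⟩
  fibreSum comp w (punchIn q a) + δ p (punchIn q a) * fibreSum comp w q ∎

Same : ∀ {n} → Fin n → Fin n → Fin n → Fin n → Set
Same u v a b = (a ≡ u × b ≡ v) ⊎ (a ≡ v × b ≡ u)

same? : ∀ {n} (u v a b : Fin n) → Dec (Same u v a b)
same? u v a b = ((a ≟ u) ×-dec (b ≟ v)) ⊎-dec ((a ≟ v) ×-dec (b ≟ u))

addEdge : ∀ {n} → Fin n → Fin n → Graph n → Graph n
addEdge u v H = tabulate λ a → tabulate λ b → does (same? u v a b) ∨ lookup (lookup H a) b

-- The spanning trees T with H ⊆ T ⊆ H ∪ E, where comp labels the components of the forest H.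
trees : ∀ {n c} → Edges n → Graph n → (Fin n → Fin (suc c)) → List (Graph n)
trees {c = zero}  E             H comp = H ∷ []
trees {c = suc c} []            H comp = []
trees {c = suc c} ((u , v) ∷ E) H comp with comp u ≟ comp v
-- The edge would be a loop after contraction: no tree that contains `H` uses it as a new edge.
... | yes _  = trees E H comp
... | no u≁v = trees E H comp ++ trees E (addEdge u v H) (merge u≁v ∘ comp)

module Bordered {n} (d : ℚ) (û v̂ : Fin n → ℚ) where

  border : ∀ {c} → (Fin n → Fin c) → Matrix (suc c)
  border comp zero    zero    = d
  border comp zero    (suc q) = fibreSum comp v̂ q
  border comp (suc p) zero    = fibreSum comp û p
  border comp (suc p) (suc q) = 0ℚ

  -- The Laplacian as the sum of x xᵀ over the edges, where x is the edge vector of the component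
  -- labels. Dropping the head of the list is deletion, and x vanishes at index zero, which is left
  -- to the border.
  bordered : ∀ {c} → Edges n → (Fin n → Fin c) → Matrix (suc c)
  bordered []            comp a b = border comp a b
  bordered ((u , v) ∷ E) comp a b = bordered E comp a b +
    edgeVector (suc (comp u)) (suc (comp v)) a * edgeVector (suc (comp u)) (suc (comp v)) b

  bordered-loop : ∀ {c} {u v} {E} {comp : Fin n → Fin c} → comp u ≡ comp v → ∀ a b →
    bordered ((u , v) ∷ E) comp a b ≡ bordered E comp a b
  bordered-loop {u = u} {v} {E} {comp} eq a b = begin
    bordered E comp a b + edgeVector (suc (comp u)) (suc (comp v)) a * edgeVector (suc (comp u)) (suc (comp v)) b
      ≡⟨ cong (λ p → bordered E comp a b + edgeVector (suc p) (suc (comp v)) a * edgeVector (suc p) (suc (comp v)) b) eq ⟩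
    bordered E comp a b + edgeVector (suc (comp v)) (suc (comp v)) a * edgeVector (suc (comp v)) (suc (comp v)) b
      ≡⟨ solve 3 (λ x y z → x :+ (y :- y) :* (z :- z) := x) refl (bordered E comp a b) (δ (suc (comp v)) a) (δ (suc (comp v)) b) ⟩
    bordered E comp a b ∎

  contract-border : ∀ {c} (comp : Fin n → Fin (suc c)) {p q} (p≢q : p ≢ q) a b →
    contract (suc p) (suc q) (border comp) a b ≡ border (merge p≢q ∘ comp) a b
  contract-border comp {p} {q} p≢q zero zero =
    solve 3 (λ d x y → d :+ con 0ℚ :* x :+ con 0ℚ :* (y :+ con 0ℚ :* con 0ℚ) := d) refl d (fibreSum comp û q) (fibreSum comp v̂ q)
  contract-border comp {p} {q} p≢q zero (suc b) = begin
    fibreSum comp v̂ (punchIn q b) + 0ℚ * 0ℚ + δ (suc p) (suc (punchIn q b)) * (fibreSum comp v̂ q + 0ℚ * 0ℚ)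
      ≡⟨ cong (λ x → fibreSum comp v̂ (punchIn q b) + 0ℚ * 0ℚ + x * (fibreSum comp v̂ q + 0ℚ * 0ℚ)) (δ-suc p (punchIn q b)) ⟩
    fibreSum comp v̂ (punchIn q b) + 0ℚ * 0ℚ + δ p (punchIn q b) * (fibreSum comp v̂ q + 0ℚ * 0ℚ)
      ≡⟨ solve 3 (λ x y z → x :+ con 0ℚ :* con 0ℚ :+ y :* (z :+ con 0ℚ :* con 0ℚ) := x :+ y :* z) refl
           (fibreSum comp v̂ (punchIn q b)) (δ p (punchIn q b)) (fibreSum comp v̂ q) ⟩
    fibreSum comp v̂ (punchIn q b) + δ p (punchIn q b) * fibreSum comp v̂ q
      ≡⟨ fibreSum-merge comp v̂ p≢q b ⟨
    fibreSum (merge p≢q ∘ comp) v̂ b ∎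
  contract-border comp {p} {q} p≢q (suc a) zero = begin
    fibreSum comp û (punchIn q a) + δ (suc p) (suc (punchIn q a)) * fibreSum comp û q + 0ℚ * (0ℚ + δ (suc p) (suc (punchIn q a)) * 0ℚ)
      ≡⟨ cong (λ x → fibreSum comp û (punchIn q a) + x * fibreSum comp û q + 0ℚ * (0ℚ + x * 0ℚ)) (δ-suc p (punchIn q a)) ⟩
    fibreSum comp û (punchIn q a) + δ p (punchIn q a) * fibreSum comp û q + 0ℚ * (0ℚ + δ p (punchIn q a) * 0ℚ)
      ≡⟨ solve 3 (λ x y z → x :+ y :* z :+ con 0ℚ :* (con 0ℚ :+ y :* con 0ℚ) := x :+ y :* z) refl
           (fibreSum comp û (punchIn q a)) (δ p (punchIn q a)) (fibreSum comp û q) ⟩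
    fibreSum comp û (punchIn q a) + δ p (punchIn q a) * fibreSum comp û q
      ≡⟨ fibreSum-merge comp û p≢q a ⟨
    fibreSum (merge p≢q ∘ comp) û a ∎
  contract-border comp {p} {q} p≢q (suc a) (suc b) =
    solve 2 (λ x y → con 0ℚ :+ x :* con 0ℚ :+ y :* (con 0ℚ :+ x :* con 0ℚ) := con 0ℚ) refl
      (δ (suc p) (suc (punchIn q a))) (δ (suc p) (suc (punchIn q b)))

  -- Contraction acts on x xᵀ by adding coordinate `q` of x to coordinate `p` and dropping `q`. By
  -- `δ-suc-merge` this gives the edge vector of the merged labels.
  contract-bordered : ∀ {c} E (comp : Fin n → Fin (suc c)) {p q} (p≢q : p ≢ q) a b →
    contract (suc p) (suc q) (bordered E comp) a b ≡ bordered E (merge p≢q ∘ comp) a b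
  contract-bordered []            comp p≢q a b = contract-border comp p≢q a b
  contract-bordered ((u , v) ∷ E) comp {p} {q} p≢q a b = begin
    contract (suc p) (suc q) (bordered ((u , v) ∷ E) comp) a b
      ≡⟨ solve 9 (λ ab qb aq qq xa xb xq pa pb →
           ab :+ xa :* xb :+ pa :* (qb :+ xq :* xb) :+ pb :* (aq :+ xa :* xq :+ pa :* (qq :+ xq :* xq))
           := ab :+ pa :* qb :+ pb :* (aq :+ pa :* qq) :+ (xa :+ pa :* xq) :* (xb :+ pb :* xq)) refl
           (A (ι a) (ι b)) (A (suc q) (ι b)) (A (ι a) (suc q)) (A (suc q) (suc q))
           (x (ι a)) (x (ι b)) (x (suc q)) (δ (suc p) (ι a)) (δ (suc p) (ι b)) ⟩
    contract (suc p) (suc q) A a b + (x (ι a) + δ (suc p) (ι a) * x (suc q)) * (x (ι b) + δ (suc p) (ι b) * x (suc q))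
      ≡⟨ cong₂ _+_ (contract-bordered E comp p≢q a b) (cong₂ _*_ (vector a) (vector b)) ⟩
    bordered ((u , v) ∷ E) (merge p≢q ∘ comp) a b ∎
    where
    A = bordered E comp
    x = edgeVector (suc (comp u)) (suc (comp v))
    ι = punchIn (suc q)
    vector : ∀ a → x (ι a) + δ (suc p) (ι a) * x (suc q) ≡ edgeVector (suc (merge p≢q (comp u))) (suc (merge p≢q (comp v))) a
    vector a = begin
      x (ι a) + δ (suc p) (ι a) * x (suc q)
        ≡⟨ solve 5 (λ u v p u′ v′ → u :- v :+ p :* (u′ :- v′) := (u :+ p :* u′) :- (v :+ p :* v′)) refl
             (δ (suc (comp u)) (ι a)) (δ (suc (comp v)) (ι a)) (δ (suc p) (ι a)) (δ (suc (comp u)) (suc q)) (δ (suc (comp v)) (suc q)) ⟩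
      (δ (suc (comp u)) (ι a) + δ (suc p) (ι a) * δ (suc (comp u)) (suc q)) - (δ (suc (comp v)) (ι a) + δ (suc p) (ι a) * δ (suc (comp v)) (suc q))
        ≡⟨ cong₂ _-_ (δ-suc-merge p≢q (comp u) a) (δ-suc-merge p≢q (comp v) a) ⟨
      edgeVector (suc (merge p≢q (comp u))) (suc (merge p≢q (comp v))) a ∎

  fibreSum-total : ∀ (comp : Fin n → Fin 1) w → fibreSum comp w zero ≡ sumℚ w
  fibreSum-total comp w = sum-cong λ x → trans (cong (λ p → δ p zero * w x) (fin1-≡ (comp x) zero)) (ℚ.*-identityˡ (w x))

  -- Source of the sign and of the factor: with one label the matrix is [[d , Σv̂] , [Σû , 0]].
  det-border₁ : ∀ (comp : Fin n → Fin 1) → det (border comp) ≡ - (sumℚ û * sumℚ v̂)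
  det-border₁ comp = begin
    det (border comp)
      ≡⟨ solve 3 (λ d u v → con 1ℚ :* d :* (con 1ℚ :* con 0ℚ :* con 1ℚ :+ con 0ℚ) :+
                             ((:- con 1ℚ) :* v :* (con 1ℚ :* u :* con 1ℚ :+ con 0ℚ) :+ con 0ℚ) := :- (u :* v)) refl
           d (fibreSum comp û zero) (fibreSum comp v̂ zero) ⟩
    - (fibreSum comp û zero * fibreSum comp v̂ zero)
      ≡⟨ cong₂ (λ x y → - (x * y)) (fibreSum-total comp û) (fibreSum-total comp v̂) ⟩
    - (sumℚ û * sumℚ v̂) ∎

  -- Below row zero only column zero can be nonzero, and every minor along row zero keeps some other
  -- column.
  det-border₂ : ∀ {c} (comp : Fin n → Fin (suc (suc c))) → det (border comp) ≡ 0ℚ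
  det-border₂ comp = sum-≡0 λ j →
    trans (cong (sgn j * border comp zero j *_) (det-zero-col (minor zero j (border comp)) (suc zero) (vanish j)))
          (ℚ.*-zeroʳ (sgn j * border comp zero j))
    where
    vanish : ∀ j r → minor zero j (border comp) r (suc zero) ≡ 0ℚ
    vanish zero    r = refl
    vanish (suc j) r = refl

  -- The cases are those of `trees`. An edge inside a component has edge vector zero; for any other
  -- edge, the two terms of deletion and contraction count the two halves of the list.
  det-bordered : ∀ {c} E H (comp : Fin n → Fin (suc c)) →
    det (bordered E comp) ≡ - (sumℚ û * sumℚ v̂) * ℕ→ℚ (length (trees E H comp))
  det-bordered {zero} []            H comp = trans (det-border₁ comp) (sym (ℚ.*-identityʳ (- (sumℚ û * sumℚ v̂))))
  det-bordered {zero} ((u , v) ∷ E) H comp =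
    trans (det-cong (bordered-loop {E = E} (fin1-≡ (comp u) (comp v)))) (det-bordered E H comp)
  det-bordered {suc c} []            H comp = trans (det-border₂ comp) (sym (ℚ.*-zeroʳ (- (sumℚ û * sumℚ v̂))))
  det-bordered {suc c} ((u , v) ∷ E) H comp with comp u ≟ comp v
  ... | yes u~v = trans (det-cong (bordered-loop {E = E} u~v)) (det-bordered E H comp)
  ... | no u≁v  = begin
    det (bordered ((u , v) ∷ E) comp)
      ≡⟨ det-deletion-contraction (u≁v ∘ Fin.suc-injective) (bordered E comp) ⟩
    det (bordered E comp) + det (contract (suc (comp u)) (suc (comp v)) (bordered E comp))
      ≡⟨ cong₂ _+_ (det-bordered E H comp)
           (trans (det-cong (contract-bordered E comp u≁v)) (det-bordered E (addEdge u v H) (merge u≁v ∘ comp))) ⟩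
    κ * ℕ→ℚ (length xs) + κ * ℕ→ℚ (length ys)
      ≡⟨ ℚ.*-distribˡ-+ κ (ℕ→ℚ (length xs)) (ℕ→ℚ (length ys)) ⟨
    κ * (ℕ→ℚ (length xs) + ℕ→ℚ (length ys))
      ≡⟨ cong (κ *_) (trans (cong ℕ→ℚ (List.length-++ xs)) (ℕ→ℚ-+ (length xs) (length ys))) ⟨
    κ * ℕ→ℚ (length (xs ++ ys)) ∎
    where
    κ = - (sumℚ û * sumℚ v̂)
    xs = trees E H comp
    ys = trees E (addEdge u v H) (merge u≁v ∘ comp)

-- Adjacency matrices and walks

private
  variable
    n c : ℕ
    R : Rel (Fin n) 0ℓ
    T H : Graph n
    E : Edges n
    a b u v : Fin n

adj? : (A : Graph n) (u v : Fin n) → Dec (Adj A u v)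
adj? A u v = lookup (lookup A u) v Bool.≟ true

graph-ext : (∀ u v → Adj T u v → Adj H u v) → (∀ u v → Adj H u v → Adj T u v) → T ≡ H
graph-ext {T = T} {H} T⊆H H⊆T = vec-ext λ u → vec-ext λ v → bool-ext (T⊆H u v) (H⊆T u v)
  where
  vec-ext : ∀ {A : Set} {k} {xs ys : Vec A k} → (∀ i → lookup xs i ≡ lookup ys i) → xs ≡ ys
  vec-ext {xs = xs} {ys} h = trans (sym (Vec.tabulate∘lookup xs)) (trans (Vec.tabulate-cong h) (Vec.tabulate∘lookup ys))
  bool-ext : ∀ {x y} → (x ≡ true → y ≡ true) → (y ≡ true → x ≡ true) → x ≡ y
  bool-ext {true}  {y}     f g = sym (f refl)
  bool-ext {false} {true}  f g = g refl
  bool-ext {false} {false} f g = refl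

reach⇒star : Reach T u v → Star (Adj T) u v
reach⇒star here       = ε
reach⇒star (step r s) = r ◅ reach⇒star s

star⇒reach : Star (Adj T) u v → Reach T u v
star⇒reach ε       = here
star⇒reach (r ◅ s) = step r (star⇒reach s)

-- Simple paths and cycles

cut : ∀ {x xs} → x ∈ xs → Linked R (xs ++ b ∷ []) → Unique (b ∷ xs) →
  ∃ λ ws → Linked R (x ∷ ws ++ b ∷ []) × Unique (b ∷ x ∷ ws)
cut (here refl) l u = _ , l , u
cut (there {xs = xs@(_ ∷ _)} x∈xs) l ((_ ∷ b∉xs) ∷ (_ ∷ u)) = cut x∈xs (Linked.tail l) (b∉xs ∷ u)

-- If the start recurs on the path found so far, the part before the recurrence is cut off. The end
-- `b` comes first in `Unique`, so that an edge from `b` to `a` closes the path to a cycle in the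
-- form of `HasCycle`.
simple-path : Star R a b → a ≡ b ⊎ ∃ λ ws → Linked R (a ∷ ws ++ b ∷ []) × Unique (b ∷ a ∷ ws)
simple-path ε = inj₁ refl
simple-path {a = a} {b} (_◅_ {j = w} r s) with a ≟ b
... | yes a≡b = inj₁ a≡b
... | no a≢b with simple-path s
...   | inj₁ refl = inj₂ ([] , r ∷ [-] , ((a≢b ∘ sym) ∷ []) ∷ [] ∷ [])
...   | inj₂ (ws , l , b∉ ∷ u) with DecMembership._∈?_ _≟_ a (w ∷ ws)
...     | yes a∈ = inj₂ (cut a∈ l (b∉ ∷ u))
...     | no a∉  = inj₂ (w ∷ ws , r ∷ l , ((a≢b ∘ sym) ∷ b∉) ∷ All.tabulate (λ {x} x∈ a≡x → a∉ (subst (_∈ w ∷ ws) (sym a≡x) x∈)) ∷ u)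

-- Since `R` lacks the edge ab, the simple path has an inner vertex, and the cycle has at least
-- three vertices. For `R` serves `T` without one edge, and also a forest inside `T`.
chord⇒cycle : ∀ (T : Graph n) → IsSimple T → (∀ {x y} → R x y → Adj T x y) → Adj T a b → ¬ R a b → Star R a b → HasCycle T
chord⇒cycle T (T-sym , T-irr) R⊆T ab ¬Rab s with simple-path s
... | inj₁ refl = contradiction ab (T-irr _)
... | inj₂ ([] , r ∷ _ , _) = contradiction r ¬Rab
... | inj₂ (w ∷ ws , l , u) = _ , _ ∷ w ∷ ws , s≤s (s≤s z≤n) , u , T-sym _ _ ab ∷ Linked.map R⊆T l

Minus : Graph n → Fin n → Fin n → Rel (Fin n) 0ℓ
Minus T a b x y = Adj T x y × ¬ Same a b x y

-- Acyclicity restated through walks: the effect of a new edge is then a question of splitting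
-- walks, not of lists of distinct vertices.
Bridges : Graph n → Set
Bridges T = ∀ a b → Adj T a b → ¬ Star (Minus T a b) a b

acyclic⇒bridges : ∀ (T : Graph n) → IsSimple T → Acyclic T → Bridges T
acyclic⇒bridges T simple acyclic a b ab s = acyclic
  (chord⇒cycle T simple proj₁ ab (λ { (_ , ¬same) → ¬same (inj₁ (refl , refl)) }) s)

-- On a cycle v, v₁, v₂, ... the walk from v₁ over v₂ back to v avoids the edge between v and v₁:
-- its first step ends at v₂, and every later step starts at a vertex other than v and v₁.
bridges⇒acyclic : ∀ (T : Graph n) → IsSimple T → Bridges T → Acyclic T
bridges⇒acyclic _ _ _ (_ , [] , () , _)
bridges⇒acyclic _ _ _ (_ , _ ∷ [] , s≤s () , _)
bridges⇒acyclic T (T-sym , _) bridges (v , v₁ ∷ v₂ ∷ vs , _ , (v≢v₁ ∷ v≢v₂ ∷ v∉) ∷ (v₁≢v₂ ∷ v₁∉) ∷ _ , e ∷ e₁ ∷ l) =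
  bridges v₁ v (T-sym _ _ e)
    ((e₁ , λ { (inj₁ (_ , v₂≡v)) → v≢v₂ (sym v₂≡v) ; (inj₂ (v₁≡v , _)) → v≢v₁ (sym v₁≡v) }) ◅
     walk v₂ vs l ((v≢v₂ ∘ sym , v₁≢v₂ ∘ sym) ∷ All.zipWith (λ (p , q) → p ∘ sym , q ∘ sym) (v∉ , v₁∉)))
  where
  avoid : ∀ {x y} → Adj T x y → x ≢ v × x ≢ v₁ → Minus T v₁ v x y
  avoid xy (x≢v , x≢v₁) = xy , λ { (inj₁ (x≡v₁ , _)) → x≢v₁ x≡v₁ ; (inj₂ (x≡v , _)) → x≢v x≡v }
  walk : ∀ x xs → Linked (Adj T) (x ∷ xs ++ v ∷ []) → All (λ y → y ≢ v × y ≢ v₁) (x ∷ xs) → Star (Minus T v₁ v) x v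
  walk x []       (xy ∷ _) (x≢ ∷ _)  = avoid xy x≢ ◅ ε
  walk x (y ∷ xs) (xy ∷ l) (x≢ ∷ xs≢) = avoid xy x≢ ◅ walk y xs l xs≢

-- Adding an edge

same-sym : Same u v a b → Same a b u v
same-sym (inj₁ (refl , refl)) = inj₁ (refl , refl)
same-sym (inj₂ (refl , refl)) = inj₂ (refl , refl)

same-flip : Same u v a b → Same u v b a
same-flip (inj₁ (p , q)) = inj₂ (q , p)
same-flip (inj₂ (p , q)) = inj₁ (q , p)

same-resp : Same u v a b → ∀ {x y} → Same u v x y → Same a b x y
same-resp (inj₁ (refl , refl)) s = s
same-resp (inj₂ (refl , refl)) s = Sum.swap s

lookup-addEdge : ∀ u v (H : Graph n) a b →
  lookup (lookup (addEdge u v H) a) b ≡ (does (same? u v a b) ∨ lookup (lookup H a) b)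
lookup-addEdge u v H a b = trans
  (cong (λ row → lookup row b) (Vec.lookup∘tabulate (λ a → tabulate λ b → does (same? u v a b) ∨ lookup (lookup H a) b) a))
  (Vec.lookup∘tabulate (λ b → does (same? u v a b) ∨ lookup (lookup H a) b) b)

addEdge-new : ∀ (H : Graph n) → Same u v a b → Adj (addEdge u v H) a b
addEdge-new {u = u} {v} {a} {b} H s = trans (lookup-addEdge u v H a b) (cong (_∨ lookup (lookup H a) b) (dec-true (same? u v a b) s))

addEdge-⊆ : ∀ (H : Graph n) → H ⊆ᴳ addEdge u v H
addEdge-⊆ {u = u} {v} H a b ab = trans (lookup-addEdge u v H a b)
  (trans (cong (does (same? u v a b) ∨_) ab) (Bool.∨-zeroʳ (does (same? u v a b))))

addEdge-⁻ : ∀ (H : Graph n) a b → Adj (addEdge u v H) a b → Same u v a b ⊎ Adj H a b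
addEdge-⁻ {u = u} {v} H a b ab with same? u v a b
... | yes s = inj₁ s
... | no ¬s = inj₂ (trans (cong (_∨ lookup (lookup H a) b) (sym (dec-false (same? u v a b) ¬s)))
                          (trans (sym (lookup-addEdge u v H a b)) ab))

-- Forests with labelled components

-- The invariant along the recursion of `trees`: `H` is a forest and the labels are its components.
-- By surjectivity a second label means a second component, so that `H` is not yet connected.
record Labelled {n c} (H : Graph n) (comp : Fin n → Fin c) : Set where
  field
    simple     : IsSimple H
    bridges    : Bridges H
    connect    : ∀ u v → comp u ≡ comp v → Star (Adj H) u v
    constant   : ∀ u v → Adj H u v → comp u ≡ comp v
    surjective : ∀ p → ∃ λ v → comp v ≡ p

  constant* : ∀ {u v} → Star (Adj H) u v → comp u ≡ comp v
  constant* = Star.fold (λ u v → comp u ≡ comp v) (λ r eq → trans (constant _ _ r) eq) refl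

-- Only the pieces before the first and after the last crossing of uv matter. If they meet at the
-- same end of uv, they form one walk in `R`.
split-star : Star (λ x y → Same u v x y ⊎ R x y) a b →
  Star R a b ⊎ (Star R a u × Star R v b) ⊎ (Star R a v × Star R u b)
split-star ε = inj₁ ε
split-star (inj₂ r ◅ s) = Sum.map (r ◅_) (Sum.map (λ (p , q) → r ◅ p , q) (λ (p , q) → r ◅ p , q)) (split-star s)
split-star (inj₁ (inj₁ (refl , refl)) ◅ s) with split-star s
... | inj₁ p              = inj₂ (inj₁ (ε , p))
... | inj₂ (inj₁ (_ , p)) = inj₂ (inj₁ (ε , p))
... | inj₂ (inj₂ (_ , p)) = inj₁ p
split-star (inj₁ (inj₂ (refl , refl)) ◅ s) with split-star s
... | inj₁ p              = inj₂ (inj₂ (ε , p))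
... | inj₂ (inj₁ (_ , p)) = inj₁ p
... | inj₂ (inj₂ (_ , p)) = inj₂ (inj₂ (ε , p))

labelled-addEdge : ∀ {comp : Fin n → Fin (suc c)} → Labelled H comp → (u≁v : comp u ≢ comp v) →
  Labelled (addEdge u v H) (merge u≁v ∘ comp)
labelled-addEdge {H = H} {u = u} {v} {comp} L u≁v = record
  { simple     = (λ a b ab → Sum.[ addEdge-new H ∘ same-flip , addEdge-⊆ H _ _ ∘ proj₁ simple a b ] (addEdge-⁻ H a b ab))
               , (λ a aa → Sum.[ loop , proj₂ simple a ] (addEdge-⁻ H a a aa))
  ; bridges    = bridges′
  ; connect    = connect′
  ; constant   = λ a b ab → Sum.[ same⇒≡ , cong (merge u≁v) ∘ constant a b ] (addEdge-⁻ H a b ab)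
  ; surjective = surjective′
  }
  where
  open Labelled L
  H⁺ = addEdge u v H
  loop : ∀ {a} → ¬ Same u v a a
  loop (inj₁ (refl , refl)) = u≁v refl
  loop (inj₂ (refl , refl)) = u≁v refl
  same⇒≡ : ∀ {a b} → Same u v a b → merge u≁v (comp a) ≡ merge u≁v (comp b)
  same⇒≡ (inj₁ (refl , refl)) = merge-identifies u≁v
  same⇒≡ (inj₂ (refl , refl)) = sym (merge-identifies u≁v)
  old : ∀ {a b} → Star (Adj H) a b → Star (Adj H⁺) a b
  old = Star.map (addEdge-⊆ H _ _)
  connect′ : ∀ a b → merge u≁v (comp a) ≡ merge u≁v (comp b) → Star (Adj H⁺) a b
  connect′ a b eq with merge-≡ u≁v eq
  ... | inj₁ a~b               = old (connect a b a~b)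
  ... | inj₂ (inj₁ (a~u , b~v)) = old (connect a u a~u) ◅◅ addEdge-new H (inj₁ (refl , refl)) ◅ old (connect v b (sym b~v))
  ... | inj₂ (inj₂ (a~v , b~u)) = old (connect a v a~v) ◅◅ addEdge-new H (inj₂ (refl , refl)) ◅ old (connect u b (sym b~u))
  surjective′ : ∀ p → ∃ λ x → merge u≁v (comp x) ≡ p
  surjective′ p with surjective (punchIn (comp v) p)
  ... | x , eq = x , trans (cong (merge u≁v) eq) (merge-punchIn u≁v p)
  -- A detour around the new edge would lie in `H` and join different labels. A detour around an old
  -- edge ab either lies in `H` or crosses uv; in the latter case its pieces and ab join u to v
  -- inside `H`.
  bridges′ : Bridges H⁺
  bridges′ a b ab s with addEdge-⁻ H a b ab
  ... | inj₁ same = ends same (constant* (Star.map onlyOld s))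
    where
    onlyOld : ∀ {x y} → Minus H⁺ a b x y → Adj H x y
    onlyOld {x} {y} (xy , ¬same) with addEdge-⁻ H x y xy
    ... | inj₁ same′ = contradiction (same-resp same same′) ¬same
    ... | inj₂ xy′   = xy′
    ends : Same u v a b → comp a ≢ comp b
    ends (inj₁ (refl , refl)) = u≁v
    ends (inj₂ (refl , refl)) = u≁v ∘ sym
  ... | inj₂ ab′ with split-star (Star.map (λ { {x} {y} (xy , ¬same) → Sum.map₂ (_, ¬same) (addEdge-⁻ H x y xy) }) s)
  ...   | inj₁ p = bridges a b ab′ p
  ...   | inj₂ (inj₁ (p , q)) = u≁v (trans (sym (constant* (Star.map proj₁ p))) (trans (constant a b ab′) (sym (constant* (Star.map proj₁ q)))))
  ...   | inj₂ (inj₂ (p , q)) = u≁v (trans (constant* (Star.map proj₁ q)) (trans (sym (constant a b ab′)) (constant* (Star.map proj₁ p))))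

-- The list of trees

InE : Edges n → Fin n → Fin n → Set
InE E a b = Any (λ (u , v) → Same u v a b) E

record Extends {n} (E : Edges n) (H T : Graph n) : Set where
  field
    simple    : IsSimple T
    connected : Connected T
    acyclic   : Acyclic T
    contains  : H ⊆ᴳ T
    within    : ∀ a b → Adj T a b → Adj H a b ⊎ InE E a b

-- `H` already joins the ends of such an edge, so an edge of `T` outside `H` would close a cycle in
-- `T`.
closed : ∀ (T : Graph n) {comp : Fin n → Fin c} → Labelled H comp → Extends E H T → Adj T a b → comp a ≡ comp b → Adj H a b
closed {H = H} {a = a} {b} T L X ab a~b with adj? H a b
... | yes ab′ = ab′
... | no ¬ab′ = contradiction (chord⇒cycle T simple (contains _ _) ab ¬ab′ (Labelled.connect L a b a~b)) acyclic
  where open Extends X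

Distinct : Edges n → Set
Distinct = AllPairs λ (u , v) (a , b) → ¬ Same u v a b

weaken : ∀ {e} → Extends E H T → Extends (e ∷ E) H T
weaken X = record { Extends X ; within = λ a b ab → Sum.map₂ there (Extends.within X a b ab) }

drop-edge : ∀ {e} → (∀ a b → Adj T a b → Same (proj₁ e) (proj₂ e) a b → Adj H a b) → Extends (e ∷ E) H T → Extends E H T
drop-edge {T = T} {H} {E = E} h X = record { Extends X ; within = within′ }
  where
  within′ : ∀ a b → Adj T a b → Adj H a b ⊎ InE E a b
  within′ a b ab with Extends.within X a b ab
  ... | inj₁ ab′       = inj₁ ab′
  ... | inj₂ (here s)  = inj₁ (h a b ab s)
  ... | inj₂ (there i) = inj₂ i

remove-added : Extends E (addEdge u v H) T → Extends ((u , v) ∷ E) H T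
remove-added {E = E} {u = u} {v} {H} {T} X = record
  { Extends X ; contains = λ a b → Extends.contains X a b ∘ addEdge-⊆ H a b ; within = within′ }
  where
  within′ : ∀ a b → Adj T a b → Adj H a b ⊎ InE ((u , v) ∷ E) a b
  within′ a b ab with Extends.within X a b ab
  ... | inj₂ i   = inj₂ (there i)
  ... | inj₁ ab′ = Sum.[ inj₂ ∘ here , inj₁ ] (addEdge-⁻ H a b ab′)

add-edge : Adj T u v → Extends ((u , v) ∷ E) H T → Extends E (addEdge u v H) T
add-edge {T = T} {u} {v} {E} {H} uv X = record { Extends X ; contains = contains′ ; within = within′ }
  where
  contains′ : addEdge u v H ⊆ᴳ T
  contains′ a b ab with addEdge-⁻ H a b ab
  ... | inj₁ (inj₁ (refl , refl)) = uv
  ... | inj₁ (inj₂ (refl , refl)) = proj₁ (Extends.simple X) _ _ uv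
  ... | inj₂ ab′                  = Extends.contains X a b ab′
  within′ : ∀ a b → Adj T a b → Adj (addEdge u v H) a b ⊎ InE E a b
  within′ a b ab with Extends.within X a b ab
  ... | inj₁ ab′       = inj₁ (addEdge-⊆ H a b ab′)
  ... | inj₂ (here s)  = inj₁ (addEdge-new H s)
  ... | inj₂ (there i) = inj₂ i

trees-sound : ∀ E {H : Graph n} {comp : Fin n → Fin (suc c)} → Labelled H comp → T ∈ trees E H comp → Extends E H T
trees-sound {c = zero} E {H} {comp = comp} L (here refl) = record
  { simple    = simple
  ; connected = λ u v → star⇒reach (connect u v (fin1-≡ (comp u) (comp v)))
  ; acyclic   = bridges⇒acyclic H simple bridges
  ; contains  = λ _ _ → id
  ; within    = λ _ _ → inj₁
  }
  where
  open Labelled L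
trees-sound {c = suc c} ((u , v) ∷ E) {H} {comp} L T∈ with comp u ≟ comp v
... | yes _  = weaken (trees-sound E L T∈)
... | no u≁v with ∈-++⁻ (trees E H comp) T∈
...   | inj₁ T∈₁ = weaken (trees-sound E L T∈₁)
...   | inj₂ T∈₂ = remove-added (trees-sound E (labelled-addEdge L u≁v) T∈₂)

trees-complete : ∀ E {H : Graph n} {comp : Fin n → Fin (suc c)} → Labelled H comp → Extends E H T → T ∈ trees E H comp
trees-complete {c = zero} {T = T} E {comp = comp} L X = here (graph-ext (λ a b ab → closed T L X ab (fin1-≡ (comp a) (comp b))) (Extends.contains X))
trees-complete {c = suc c} {T = T} [] {H} {comp} L X with surjective zero | surjective (suc zero)
  where open Labelled L
-- With no edges left `T` lies in `H`, so no walk in `T` leads from label zero to label one.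
... | x , eq | y , eq′ = contradiction (trans (sym eq) (trans (Labelled.constant* L (Star.map T⊆H (reach⇒star (Extends.connected X x y)))) eq′)) λ ()
  where
  T⊆H : ∀ {a b} → Adj T a b → Adj H a b
  T⊆H ab with Extends.within X _ _ ab
  ... | inj₁ ab′ = ab′
trees-complete {c = suc c} {T = T} ((u , v) ∷ E) {H} {comp} L X with comp u ≟ comp v
... | yes u~v = trees-complete E L (drop-edge (λ a b ab s → closed T L X ab (ends s)) X)
  where
  ends : ∀ {a b} → Same u v a b → comp a ≡ comp b
  ends (inj₁ (refl , refl)) = u~v
  ends (inj₂ (refl , refl)) = sym u~v
... | no u≁v with adj? T u v
...   | yes uv = ∈-++⁺ʳ (trees E H comp) (trees-complete E (labelled-addEdge L u≁v) (add-edge uv X))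
...   | no ¬uv = ∈-++⁺ˡ (trees-complete E L (drop-edge (λ a b ab s → contradiction (edge s ab) ¬uv) X))
  where
  edge : ∀ {a b} → Same u v a b → Adj T a b → Adj T u v
  edge (inj₁ (refl , refl)) ab = ab
  edge (inj₂ (refl , refl)) ab = proj₁ (Extends.simple X) _ _ ab

-- Trees in the second half contain uv and those in the first do not: uv is not in `H`, since its
-- ends carry different labels, and `Distinct`, which compares unordered pairs, keeps it out of `E`.
trees-unique : ∀ E {H : Graph n} {comp : Fin n → Fin (suc c)} → Distinct E → Labelled H comp → Unique (trees E H comp)
trees-unique {c = zero}  E  D L = [] ∷ []
trees-unique {c = suc c} [] D L = []
trees-unique {c = suc c} ((u , v) ∷ E) {H} {comp} (new ∷ D) L with comp u ≟ comp v
... | yes _  = trees-unique E D L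
... | no u≁v = Unique.++⁺ (trees-unique E D L) (trees-unique E D (labelled-addEdge L u≁v)) λ { (T∈₁ , T∈₂) → disjoint (trees-sound E L T∈₁) (trees-sound E (labelled-addEdge L u≁v) T∈₂) }
  where
  absent : ∀ {E} → All (λ (a , b) → ¬ Same u v a b) E → ¬ InE E u v
  absent (¬s ∷ _)  (here s)  = ¬s (same-sym s)
  absent (_ ∷ new) (there i) = absent new i
  disjoint : ∀ {T} → Extends E H T → ¬ Extends E (addEdge u v H) T
  disjoint X Y with Extends.within X u v (Extends.contains Y u v (addEdge-new H (inj₁ (refl , refl))))
  ... | inj₁ uv = u≁v (Labelled.constant L u v uv)
  ... | inj₂ i  = absent new i

-- Enumerated refinement types

lookup-injective : ∀ {A : Set} {xs : List A} → Unique xs → ∀ i j → List.lookup xs i ≡ List.lookup xs j → i ≡ j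
lookup-injective (_ ∷ _)  zero    zero    eq = refl
lookup-injective (x∉ ∷ _) zero    (suc j) eq = contradiction eq (All.lookup x∉ (∈-lookup j))
lookup-injective (x∉ ∷ _) (suc i) zero    eq = contradiction (sym eq) (All.lookup x∉ (∈-lookup i))
lookup-injective (_ ∷ u)  (suc i) (suc j) eq = cong suc (lookup-injective u i j eq)

enumerated-size : ∀ {A : Set} {P : A → Set} → DecidableEquality A → (xs : List A) → Unique xs →
  (∀ {x} → x ∈ xs → P x) → (∀ {x} → P x → x ∈ xs) → HasSize [ x ∈ A ∣ P x ] (length xs)
enumerated-size {A} {P} eq? xs unique sound complete = mk↔ₛ′ to from
  (λ x → value-injective (sym (lookup-index (member x))))
  (λ i → lookup-injective unique _ i (sym (lookup-index (member (to i)))))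
  where
  to : Fin (length xs) → [ x ∈ A ∣ P x ]
  to i = List.lookup xs i , [ sound (∈-lookup i) ]
  -- The proof `p` is irrelevant, so the position in the list cannot be computed from it. Membership
  -- is decided afresh, and `p` only refutes a negative answer.
  member : (x : [ x ∈ A ∣ P x ]) → value x ∈ xs
  member (x , [ p ]) with DecMembership._∈?_ eq? x xs
  ... | yes x∈ = x∈
  ... | no x∉  = contradiction-irr (complete p) x∉
  from : [ x ∈ A ∣ P x ] → Fin (length xs)
  from x = index (member x)

-- Sums over lists

-- The head is added on the right, in the order in which `bordered` adds its edge terms.
sumL : {A : Set} → (A → ℚ) → List A → ℚ
sumL f = foldr (λ x s → s + f x) 0ℚ

sumL-++ : ∀ {A : Set} (f : A → ℚ) xs ys → sumL f (xs ++ ys) ≡ sumL f xs + sumL f ys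
sumL-++ f []       ys = sym (ℚ.+-identityˡ (sumL f ys))
sumL-++ f (x ∷ xs) ys = trans (cong (_+ f x) (sumL-++ f xs ys))
  (solve 3 (λ a b c → (a :+ b) :+ c := (a :+ c) :+ b) refl (sumL f xs) (sumL f ys) (f x))

sumL-tabulate : ∀ {A : Set} (f : A → ℚ) {k} (g : Fin k → A) → sumL f (List.tabulate g) ≡ sumℚ (f ∘ g)
sumL-tabulate f {zero}  g = refl
sumL-tabulate f {suc k} g = trans (cong (_+ f (g zero)) (sumL-tabulate f (g ∘ suc))) (ℚ.+-comm (sumℚ (f ∘ g ∘ suc)) (f (g zero)))

sumL-map : ∀ {A B : Set} (f : B → ℚ) (g : A → B) xs → sumL f (List.map g xs) ≡ sumL (f ∘ g) xs
sumL-map f g []       = refl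
sumL-map f g (x ∷ xs) = cong (_+ f (g x)) (sumL-map f g xs)

sumL-pairs : ∀ {A B : Set} (f : A × B → ℚ) {k l} (g : Fin k → A) (h : Fin l → B) →
  sumL f (cartesianProduct (List.tabulate g) (List.tabulate h)) ≡ sumℚ (λ i → sumℚ (λ j → f (g i , h j)))
sumL-pairs f {zero}  g h = refl
sumL-pairs f {suc k} g h = begin
  sumL f (List.map (g zero ,_) (List.tabulate h) ++ cartesianProduct (List.tabulate (g ∘ suc)) (List.tabulate h))
    ≡⟨ sumL-++ f (List.map (g zero ,_) (List.tabulate h)) _ ⟩
  sumL f (List.map (g zero ,_) (List.tabulate h)) + sumL f (cartesianProduct (List.tabulate (g ∘ suc)) (List.tabulate h))
    ≡⟨ cong₂ _+_ (trans (sumL-map f (g zero ,_) (List.tabulate h)) (sumL-tabulate (λ y → f (g zero , y)) h)) (sumL-pairs f (g ∘ suc) h) ⟩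
  sumℚ (λ i → sumℚ (λ j → f (g i , h j))) ∎

sumL-cong : ∀ {A : Set} {f g : A → ℚ} → (∀ x → f x ≡ g x) → ∀ xs → sumL f xs ≡ sumL g xs
sumL-cong h []       = refl
sumL-cong h (x ∷ xs) = cong₂ _+_ (sumL-cong h xs) (h x)

sumL-zero : ∀ {A : Set} {f : A → ℚ} → (∀ x → f x ≡ 0ℚ) → ∀ xs → sumL f xs ≡ 0ℚ
sumL-zero h []       = refl
sumL-zero h (x ∷ xs) = cong₂ _+_ (sumL-zero h xs) (h x)

⟦_⟧ : Bool → ℚ
⟦ b ⟧ = if b then 1ℚ else 0ℚ

⟦∧⟧ : ∀ x y → ⟦ x ∧ y ⟧ ≡ ⟦ x ⟧ * ⟦ y ⟧
⟦∧⟧ false y = sym (ℚ.*-zeroˡ ⟦ y ⟧)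
⟦∧⟧ true  y = sym (ℚ.*-identityˡ ⟦ y ⟧)

sumL-filter : ∀ {A : Set} {P : A → Set} (P? : Decidable P) (f : A → ℚ) xs →
  sumL f (filter P? xs) ≡ sumL (λ x → ⟦ does (P? x) ⟧ * f x) xs
sumL-filter P? f []       = refl
sumL-filter P? f (x ∷ xs) with does (P? x)
... | true  = cong₂ _+_ (sumL-filter P? f xs) (sym (ℚ.*-identityˡ (f x)))
... | false = trans (sumL-filter P? f xs) (solve 2 (λ s y → s := s :+ con 0ℚ :* y) refl _ (f x))

-- Counting and positivity

sum-ones : ∀ k → sumℚ {k} (λ _ → 1ℚ) ≡ ℕ→ℚ k
sum-ones zero    = refl
sum-ones (suc k) = trans (cong (1ℚ +_) (sum-ones k)) (sym (ℕ→ℚ-+ 1 k))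

ℕ→ℚ-count : ∀ {k} (P : Fin k → Bool) → ℕ→ℚ (count P) ≡ sumℚ (λ i → ⟦ P i ⟧)
ℕ→ℚ-count {zero}  P = refl
ℕ→ℚ-count {suc k} P = trans (ℕ→ℚ-+ (if P zero then 1 else 0) (count (P ∘ suc)))
  (cong₂ _+_ (bit (P zero)) (ℕ→ℚ-count (P ∘ suc)))
  where
  bit : ∀ b → ℕ→ℚ (if b then 1 else 0) ≡ ⟦ b ⟧
  bit true  = refl
  bit false = refl

count-witness : ∀ {k} (P : Fin k → Bool) → 1 ℕ.≤ count P → ∃ λ i → P i ≡ true
count-witness {suc k} P 1≤ with P zero in eq
... | true  = zero , eq
... | false with count-witness (P ∘ suc) 1≤
...   | i , Pi = suc i , Pi

sum-nonNeg : ∀ {k} (f : Fin k → ℚ) → (∀ i → 0ℚ ℚ.≤ f i) → 0ℚ ℚ.≤ sumℚ f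
sum-nonNeg {zero}  f h = ℚ.≤-refl
sum-nonNeg {suc k} f h = ℚ.+-mono-≤ (h zero) (sum-nonNeg (f ∘ suc) (h ∘ suc))

sum-pos : ∀ {k} (f : Fin k → ℚ) → (∀ i → 0ℚ ℚ.≤ f i) → ∀ i → 0ℚ ℚ.< f i → 0ℚ ℚ.< sumℚ f
sum-pos f h zero    p = ℚ.+-mono-<-≤ p (sum-nonNeg (f ∘ suc) (h ∘ suc))
sum-pos f h (suc i) p = ℚ.+-mono-≤-< (h zero) (sum-pos (f ∘ suc) (h ∘ suc) i p)

0<1 : 0ℚ ℚ.< 1ℚ
0<1 = ℚ.positive⁻¹ 1ℚ

δ-*-nonNeg : ∀ {k} (i j : Fin k) {x} → 0ℚ ℚ.≤ x → 0ℚ ℚ.≤ δ i j * x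
δ-*-nonNeg i j {x} 0≤x with i ≟ j
... | yes _ = subst (0ℚ ℚ.≤_) (sym (ℚ.*-identityˡ x)) 0≤x
... | no _  = ℚ.≤-reflexive (sym (ℚ.*-zeroˡ x))

1-δ-nonNeg : ∀ {k} (i j : Fin k) → 0ℚ ℚ.≤ 1ℚ - δ i j
1-δ-nonNeg i j with i ≟ j
... | yes _ = ℚ.≤-refl
... | no _  = ℚ.<⇒≤ 0<1

inv-inverse : ∀ {q} → q ≢ 0ℚ → q * inv q ≡ 1ℚ
inv-inverse {q@(mkℚ +0 _ _)} q≢0 = contradiction (ℚ.↥p≡0⇒p≡0 q refl) q≢0
inv-inverse {q@(mkℚ +[1+ _ ] _ _)} _ = ℚ.*-inverseʳ q
inv-inverse {q@(mkℚ -[1+ _ ] _ _)} _ = ℚ.*-inverseʳ q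

-- The edges of a graph

edge? : (G : Graph n) (e : Fin n × Fin n) → Dec (proj₁ e Fin.< proj₂ e × Adj G (proj₁ e) (proj₂ e))
edge? G (u , v) = (u <? v) ×-dec adj? G u v

edges : Graph n → Edges n
edges {n} G = filter (edge? G) (cartesianProduct (allFin n) (allFin n))

edges-distinct : (G : Graph n) → Distinct (edges G)
edges-distinct {n} G = go (All.map proj₁ (All.all-filter (edge? G) pairs))
  (Unique.filter⁺ (edge? G) (Unique.cartesianProduct⁺ (Unique.allFin⁺ n) (Unique.allFin⁺ n)))
  where
  pairs = cartesianProduct (allFin n) (allFin n)
  apart : ∀ {u v a b : Fin n} → u Fin.< v → a Fin.< b → (u , v) ≢ (a , b) → ¬ Same u v a b
  apart _   _   ≢ (inj₁ (refl , refl)) = ≢ refl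
  apart u<v v<u ≢ (inj₂ (refl , refl)) = ℕ.<-asym u<v v<u
  go : ∀ {E} → All (λ (u , v) → u Fin.< v) E → Unique E → Distinct E
  go []         []       = []
  go (u<v ∷ hs) (u ∷ us) = All.zipWith (λ (a<b , e≢) → apart u<v a<b e≢) (hs , u) ∷ go hs us

edges-complete : ∀ (G : Graph n) → IsSimple G → Adj G a b → InE (edges G) a b
edges-complete {a = a} {b} G (G-sym , G-irr) ab with Fin.<-cmp a b
... | tri< a<b _ _  = lose (∈-filter⁺ (edge? G) (∈-cartesianProduct⁺ (∈-allFin a) (∈-allFin b)) (a<b , ab)) (inj₁ (refl , refl))
... | tri> _ _ b<a  = lose (∈-filter⁺ (edge? G) (∈-cartesianProduct⁺ (∈-allFin b) (∈-allFin a)) (b<a , G-sym _ _ ab)) (inj₂ (refl , refl))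
... | tri≈ _ refl _ = contradiction ab (G-irr a)

edges-sound : ∀ (G : Graph n) → IsSimple G → InE (edges G) a b → Adj G a b
edges-sound {n} {a} {b} G (G-sym , _) i =
  let (_ , uv) , s = All.lookupAny (All.all-filter (edge? G) (cartesianProduct (allFin n) (allFin n))) i
  in same⇒adj s uv
  where
  same⇒adj : ∀ {u v} → Same u v a b → Adj G u v → Adj G a b
  same⇒adj (inj₁ (refl , refl)) uv = uv
  same⇒adj (inj₂ (refl , refl)) uv = G-sym _ _ uv

-- The Laplacian of the complete multipartite graph in terms of the numbers `nip`

module Counting {n s c} (part : Fin n → Fin s) (comp : Fin n → Fin c) where

  open Setup part comp

  -- `B` is (J - I)N: it counts the vertices of component `p` outside part `k`.
  N B : Fin s → Fin c → ℚ
  N k p = ℕ→ℚ (nip k p)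
  B k p = ℕ→ℚ (m p) - N k p

  degree : Fin s → ℚ
  degree k = ℕ→ℚ n - ℕ→ℚ (nᵢ part k)

  nᵢ-sum : ∀ k → ℕ→ℚ (nᵢ part k) ≡ sumℚ (λ v → δ (part v) k)
  nᵢ-sum k = ℕ→ℚ-count (λ v → ⌊ part v ≟ k ⌋)

  m-sum : ∀ p → ℕ→ℚ (m p) ≡ sumℚ (λ v → δ (comp v) p)
  m-sum p = ℕ→ℚ-count (λ v → ⌊ comp v ≟ p ⌋)

  N-sum : ∀ k p → N k p ≡ sumℚ (λ v → δ (part v) k * δ (comp v) p)
  N-sum k p = trans (ℕ→ℚ-count (λ v → ⌊ part v ≟ k ⌋ ∧ ⌊ comp v ≟ p ⌋))
    (sum-cong λ v → ⟦∧⟧ ⌊ part v ≟ k ⌋ ⌊ comp v ≟ p ⌋)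

  degree-sum : ∀ k → degree k ≡ sumℚ (λ v → 1ℚ - δ (part v) k)
  degree-sum k = begin
    ℕ→ℚ n - ℕ→ℚ (nᵢ part k)                         ≡⟨ cong₂ _-_ (sym (sum-ones n)) (nᵢ-sum k) ⟩
    sumℚ {n} (λ _ → 1ℚ) - sumℚ (λ v → δ (part v) k) ≡⟨ sum-- (λ _ → 1ℚ) (λ v → δ (part v) k) ⟨
    sumℚ (λ v → 1ℚ - δ (part v) k)                  ∎

  B-sum : ∀ k p → B k p ≡ sumℚ (λ v → (1ℚ - δ (part v) k) * δ (comp v) p)
  B-sum k p = begin
    ℕ→ℚ (m p) - N k p
      ≡⟨ cong₂ _-_ (m-sum p) (N-sum k p) ⟩
    sumℚ (λ v → δ (comp v) p) - sumℚ (λ v → δ (part v) k * δ (comp v) p)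
      ≡⟨ sum-- (λ v → δ (comp v) p) (λ v → δ (part v) k * δ (comp v) p) ⟨
    sumℚ (λ v → δ (comp v) p - δ (part v) k * δ (comp v) p)
      ≡⟨ sum-cong (λ v → solve 2 (λ x y → x :- y :* x := (con 1ℚ :- y) :* x) refl (δ (comp v) p) (δ (part v) k)) ⟩
    sumℚ (λ v → (1ℚ - δ (part v) k) * δ (comp v) p) ∎

  -- The vertices of component `p` are sorted by their parts.
  regroup : ∀ p (h : Fin s → ℚ) → sumℚ (λ v → δ (comp v) p * h (part v)) ≡ sumℚ (λ k → N k p * h k)
  regroup p h = sym (begin
    sumℚ (λ k → N k p * h k)
      ≡⟨ sum-cong (λ k → trans (cong (_* h k) (N-sum k p)) (sym (sum-*ʳ (h k) (λ v → δ (part v) k * δ (comp v) p)))) ⟩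
    sumℚ (λ k → sumℚ (λ v → δ (part v) k * δ (comp v) p * h k))
      ≡⟨ sum-swap (λ k v → δ (part v) k * δ (comp v) p * h k) ⟩
    sumℚ (λ v → sumℚ (λ k → δ (part v) k * δ (comp v) p * h k))
      ≡⟨ sum-cong (λ v → trans (sum-cong λ k → ℚ.*-assoc (δ (part v) k) (δ (comp v) p) (h k)) (sum-δ (part v) (λ k → δ (comp v) p * h k))) ⟩
    sumℚ (λ v → δ (comp v) p * h (part v)) ∎)

  -- α_p is the sum of the degrees, in the complete multipartite graph, of the vertices of component
  -- `p`. Its positivity is read off from this form.
  α-sum : ∀ p → α p ≡ sumℚ (λ v → δ (comp v) p * degree (part v))
  α-sum p = sym (begin
    sumℚ (λ v → δ (comp v) p * degree (part v))
      ≡⟨ sum-cong (λ v → solve 3 (λ d n k → d :* (n :- k) := n :* d :- d :* k) refl (δ (comp v) p) (ℕ→ℚ n) (ℕ→ℚ (nᵢ part (part v)))) ⟩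
    sumℚ (λ v → ℕ→ℚ n * δ (comp v) p - δ (comp v) p * ℕ→ℚ (nᵢ part (part v)))
      ≡⟨ sum-- (λ v → ℕ→ℚ n * δ (comp v) p) (λ v → δ (comp v) p * ℕ→ℚ (nᵢ part (part v))) ⟩
    sumℚ (λ v → ℕ→ℚ n * δ (comp v) p) - sumℚ (λ v → δ (comp v) p * ℕ→ℚ (nᵢ part (part v)))
      ≡⟨ cong₂ _-_
           (trans (sum-*ˡ (ℕ→ℚ n) (λ v → δ (comp v) p)) (trans (cong (ℕ→ℚ n *_) (sym (m-sum p))) (sym (ℕ→ℚ-* n (m p)))))
           (trans (regroup p (λ k → ℕ→ℚ (nᵢ part k)))
                  (sum-cong λ k → trans (ℚ.*-comm (N k p) (ℕ→ℚ (nᵢ part k))) (sym (ℕ→ℚ-* (nᵢ part k) (nip k p))))) ⟩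
    α p ∎)

  module _ (G : Graph n) (multipartite : IsCompleteMultipartite part G) where

    weight : Fin n → Fin n → ℚ
    weight u v = ⟦ does (edge? G (u , v)) ⟧

    joined : Fin n → Fin n → ℚ
    joined u v = 1ℚ - δ (part u) (part v)

    -- Each edge is listed in one orientation only, so the two weights of a pair add up to its
    -- adjacency.
    weight-joined : ∀ u v → weight u v + weight v u ≡ joined u v
    weight-joined u v with Fin.<-cmp u v | part u ≟ part v
    ... | tri< u<v _ v≮u | no u≁v = cong₂ (λ x y → ⟦ x ⟧ + ⟦ y ⟧)
      (dec-true (edge? G (u , v)) (u<v , Equivalence.from (multipartite u v) u≁v)) (dec-false (edge? G (v , u)) (v≮u ∘ proj₁))
    ... | tri> u≮v _ v<u | no u≁v = cong₂ (λ x y → ⟦ x ⟧ + ⟦ y ⟧)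
      (dec-false (edge? G (u , v)) (u≮v ∘ proj₁)) (dec-true (edge? G (v , u)) (v<u , Equivalence.from (multipartite v u) (u≁v ∘ sym)))
    ... | tri≈ _ u≡v _   | no u≁v = contradiction (cong part u≡v) u≁v
    ... | _              | yes u~v = cong₂ (λ x y → ⟦ x ⟧ + ⟦ y ⟧)
      (dec-false (edge? G (u , v)) (λ (_ , uv) → Equivalence.to (multipartite u v) uv u~v))
      (dec-false (edge? G (v , u)) (λ (_ , vu) → Equivalence.to (multipartite v u) vu (sym u~v)))

    -- Splitting the product over an edge uv into a part for u and a part for v turns the sum
    -- over edges into a sum over all ordered pairs of adjacent vertices.
    laplacian-sum : ∀ p q →
      sumL (λ (u , v) → edgeVector (comp u) (comp v) p * edgeVector (comp u) (comp v) q) (edges G) ≡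
      δ p q * α p - sumℚ (λ k → N k p * B k q)
    laplacian-sum p q = begin
      sumL f (edges G)
        ≡⟨ sumL-filter (edge? G) f (cartesianProduct (allFin n) (allFin n)) ⟩
      sumL (λ e → ⟦ does (edge? G e) ⟧ * f e) (cartesianProduct (allFin n) (allFin n))
        ≡⟨ sumL-pairs (λ e → ⟦ does (edge? G e) ⟧ * f e) {n} {n} id id ⟩
      sumℚ (λ u → sumℚ (λ v → weight u v * f (u , v)))
        ≡⟨ sum-cong (λ u → sum-cong λ v → solve 5 (λ w a b a′ b′ →
             w :* ((a :- b) :* (a′ :- b′)) := w :* (a :* a′ :- a :* b′) :+ w :* (b :* b′ :- b :* a′)) refl
             (weight u v) (δ (comp u) p) (δ (comp v) p) (δ (comp u) q) (δ (comp v) q)) ⟩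
      sumℚ (λ u → sumℚ (λ v → weight u v * g u v + weight u v * g v u))
        ≡⟨ sum₂-+ (λ u v → weight u v * g u v) (λ u v → weight u v * g v u) ⟩
      sumℚ (λ u → sumℚ (λ v → weight u v * g u v)) + sumℚ (λ u → sumℚ (λ v → weight u v * g v u))
        ≡⟨ cong (sumℚ (λ u → sumℚ (λ v → weight u v * g u v)) +_) (sum-swap (λ u v → weight u v * g v u)) ⟩
      sumℚ (λ u → sumℚ (λ v → weight u v * g u v)) + sumℚ (λ u → sumℚ (λ v → weight v u * g u v))
        ≡⟨ sum₂-+ (λ u v → weight u v * g u v) (λ u v → weight v u * g u v) ⟨
      sumℚ (λ u → sumℚ (λ v → weight u v * g u v + weight v u * g u v))
        ≡⟨ sum-cong (λ u → sum-cong λ v → trans (sym (ℚ.*-distribʳ-+ (g u v) (weight u v) (weight v u))) (cong (_* g u v) (weight-joined u v))) ⟩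
      sumℚ (λ u → sumℚ (λ v → joined u v * g u v))
        ≡⟨ sum-cong inner ⟩
      sumℚ (λ u → δ p q * (δ (comp u) p * degree (part u)) - δ (comp u) p * B (part u) q)
        ≡⟨ sum-- (λ u → δ p q * (δ (comp u) p * degree (part u))) (λ u → δ (comp u) p * B (part u) q) ⟩
      sumℚ (λ u → δ p q * (δ (comp u) p * degree (part u))) - sumℚ (λ u → δ (comp u) p * B (part u) q)
        ≡⟨ cong₂ _-_ (trans (sum-*ˡ (δ p q) (λ u → δ (comp u) p * degree (part u))) (cong (δ p q *_) (sym (α-sum p))))
                     (regroup p (λ k → B k q)) ⟩
      δ p q * α p - sumℚ (λ k → N k p * B k q) ∎
      where
      f : Fin n × Fin n → ℚ
      f (u , v) = edgeVector (comp u) (comp v) p * edgeVector (comp u) (comp v) q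
      g : Fin n → Fin n → ℚ
      g u v = δ (comp u) p * δ (comp u) q - δ (comp u) p * δ (comp v) q
      -- The diagonal term of `g` sums to a degree, the mixed term to an entry of (J - I)N.
      inner : ∀ u → sumℚ (λ v → joined u v * g u v) ≡
        δ p q * (δ (comp u) p * degree (part u)) - δ (comp u) p * B (part u) q
      inner u = begin
        sumℚ (λ v → joined u v * g u v)
          ≡⟨ sum-cong (λ v → trans
               (cong₂ (λ x y → (1ℚ - x) * (y - δ (comp u) p * δ (comp v) q)) (δ-sym (part u) (part v)) (δ-diagonal (comp u) p q))
               (solve 4 (λ j d a b → (con 1ℚ :- j) :* (d :* a :- a :* b) := d :* a :* (con 1ℚ :- j) :- a :* ((con 1ℚ :- j) :* b)) refl
                 (δ (part v) (part u)) (δ p q) (δ (comp u) p) (δ (comp v) q))) ⟩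
        sumℚ (λ v → δ p q * δ (comp u) p * (1ℚ - δ (part v) (part u)) - δ (comp u) p * ((1ℚ - δ (part v) (part u)) * δ (comp v) q))
          ≡⟨ sum-- (λ v → δ p q * δ (comp u) p * (1ℚ - δ (part v) (part u))) (λ v → δ (comp u) p * ((1ℚ - δ (part v) (part u)) * δ (comp v) q)) ⟩
        sumℚ (λ v → δ p q * δ (comp u) p * (1ℚ - δ (part v) (part u))) - sumℚ (λ v → δ (comp u) p * ((1ℚ - δ (part v) (part u)) * δ (comp v) q))
          ≡⟨ cong₂ _-_
               (trans (sum-*ˡ (δ p q * δ (comp u) p) (λ v → 1ℚ - δ (part v) (part u)))
                 (trans (cong (δ p q * δ (comp u) p *_) (sym (degree-sum (part u)))) (ℚ.*-assoc (δ p q) (δ (comp u) p) (degree (part u)))))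
               (trans (sum-*ˡ (δ (comp u) p) (λ v → (1ℚ - δ (part v) (part u)) * δ (comp v) q))
                 (cong (δ (comp u) p *_) (sym (B-sum (part u) q)))) ⟩
        δ p q * (δ (comp u) p * degree (part u)) - δ (comp u) p * B (part u) q ∎

  module Border (i j : Fin s) (t : ℚ) where

    û v̂ : Fin n → ℚ
    û x = δ (part x) i
    v̂ x = - t * (1ℚ - δ (part x) j)

    -- The corner is the entry (0 , 0) of D - AB, namely 1 - (t e_jᵀ)(-e_i).
    open Bordered (1ℚ + t * δ i j) û v̂ public

    sum-û : sumℚ û ≡ ℕ→ℚ (nᵢ part i)
    sum-û = sym (nᵢ-sum i)

    sum-v̂ : sumℚ v̂ ≡ - t * degree j
    sum-v̂ = trans (sum-*ˡ (- t) (λ x → 1ℚ - δ (part x) j)) (cong (- t *_) (sym (degree-sum j)))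

    bordered-entry : ∀ E a b → bordered E comp a b ≡ border comp a b +
      sumL (λ (u , v) → edgeVector (suc (comp u)) (suc (comp v)) a * edgeVector (suc (comp u)) (suc (comp v)) b) E
    bordered-entry []            a b = sym (ℚ.+-identityʳ (border comp a b))
    bordered-entry ((u , v) ∷ E) a b = trans (cong (_+ x) (bordered-entry E a b)) (ℚ.+-assoc (border comp a b) _ x)
      where x = edgeVector (suc (comp u)) (suc (comp v)) a * edgeVector (suc (comp u)) (suc (comp v)) b

    d⁺ e⁺ : Fin (suc c) → ℚ
    d⁺ zero    = 1ℚ
    d⁺ (suc p) = α p
    e⁺ zero    = 1ℚ
    e⁺ (suc p) = inv (α p)

    -- Nᵀ with the row t e_jᵀ on top; `B⁺` is (J - I)N with the column -e_i in front. The added row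
    -- and column contribute -t e_i e_jᵀ to BD⁻¹A, which is the perturbation of `M`.
    A⁺ : Fin (suc c) → Fin s → ℚ
    A⁺ zero    l = t * δ j l
    A⁺ (suc p) l = N l p

    B⁺ : Fin s → Fin (suc c) → ℚ
    B⁺ k zero    = - δ i k
    B⁺ k (suc q) = B k q

    perturbed-entry : ∀ k l → δ k l - sumℚ (λ p → B⁺ k p * e⁺ p * A⁺ p l) ≡ M k l + t * (δ i k * δ j l)
    perturbed-entry k l = begin
      δ k l - (- δ i k * 1ℚ * (t * δ j l) + sumℚ (λ p → B k p * inv (α p) * N l p))
        ≡⟨ cong (λ x → δ k l - (- δ i k * 1ℚ * (t * δ j l) + x))
             (sum-cong λ p → solve 3 (λ b e a → b :* e :* a := a :* b :* e) refl (B k p) (inv (α p)) (N l p)) ⟩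
      δ k l - (- δ i k * 1ℚ * (t * δ j l) + S)
        ≡⟨ solve 5 (λ d i t j S → d :- ((:- i) :* con 1ℚ :* (t :* j) :+ S) := d :- S :+ t :* (i :* j)) refl (δ k l) (δ i k) t (δ j l) S ⟩
      M k l + t * (δ i k * δ j l) ∎
      where S = sumℚ (λ p → N l p * B k p * inv (α p))

    border-û : ∀ p → fibreSum comp û p ≡ N i p
    border-û p = trans (sum-cong λ x → ℚ.*-comm (δ (comp x) p) (δ (part x) i)) (sym (N-sum i p))

    border-v̂ : ∀ q → fibreSum comp v̂ q ≡ - t * B j q
    border-v̂ q = trans
      (sum-cong λ x → solve 3 (λ d t y → d :* (t :* y) := t :* (y :* d)) refl (δ (comp x) q) (- t) (1ℚ - δ (part x) j))
      (trans (sum-*ˡ (- t) (λ x → (1ℚ - δ (part x) j) * δ (comp x) q)) (cong (- t *_) (sym (B-sum j q))))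

    edgeVector-suc : ∀ u v p → edgeVector (suc (comp u)) (suc (comp v)) (suc p) ≡ edgeVector (comp u) (comp v) p
    edgeVector-suc u v p = cong₂ _-_ (δ-suc (comp u) p) (δ-suc (comp v) p)

    module _ (G : Graph n) (multipartite : IsCompleteMultipartite part G) where

      reduced-entry : ∀ p q → diag d⁺ p q - sumℚ (λ k → A⁺ p k * B⁺ k q) ≡ bordered (edges G) comp p q
      reduced-entry p q = trans (entry p q) (sym (bordered-entry (edges G) p q))
        where
        X : Fin (suc c) → Fin (suc c) → Fin n × Fin n → ℚ
        X p q (u , v) = edgeVector (suc (comp u)) (suc (comp v)) p * edgeVector (suc (comp u)) (suc (comp v)) q
        no-edges : ∀ {x} p q → (∀ e → X p q e ≡ 0ℚ) → x ≡ x + sumL (X p q) (edges G)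
        no-edges {x} p q h = sym (trans (cong (x +_) (sumL-zero h (edges G))) (ℚ.+-identityʳ x))
        entry : ∀ p q → diag d⁺ p q - sumℚ (λ k → A⁺ p k * B⁺ k q) ≡ border comp p q + sumL (X p q) (edges G)
        entry zero zero = trans (begin
          1ℚ * 1ℚ - sumℚ (λ k → t * δ j k * (- δ i k))
            ≡⟨ cong (λ x → 1ℚ * 1ℚ - x) (trans
                 (sum-cong λ k → solve 3 (λ t j i → t :* j :* (:- i) := j :* (:- (t :* i))) refl t (δ j k) (δ i k))
                 (sum-δ j (λ k → - (t * δ i k)))) ⟩
          1ℚ * 1ℚ - (- (t * δ i j))
            ≡⟨ solve 1 (λ x → con 1ℚ :* con 1ℚ :- (:- x) := con 1ℚ :+ x) refl (t * δ i j) ⟩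
          1ℚ + t * δ i j ∎)
          (no-edges zero zero λ _ → refl)
        entry zero (suc q) = trans (begin
          0ℚ * 1ℚ - sumℚ (λ k → t * δ j k * B k q)
            ≡⟨ cong (λ x → 0ℚ * 1ℚ - x) (trans
                 (sum-cong λ k → solve 3 (λ t j b → t :* j :* b := j :* (t :* b)) refl t (δ j k) (B k q))
                 (sum-δ j (λ k → t * B k q))) ⟩
          0ℚ * 1ℚ - t * B j q
            ≡⟨ solve 2 (λ t b → con 0ℚ :* con 1ℚ :- t :* b := (:- t) :* b) refl t (B j q) ⟩
          - t * B j q
            ≡⟨ border-v̂ q ⟨
          fibreSum comp v̂ q ∎)
          (no-edges zero (suc q) λ (u , v) → ℚ.*-zeroˡ (edgeVector (suc (comp u)) (suc (comp v)) (suc q)))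
        entry (suc p) zero = trans (begin
          0ℚ * α p - sumℚ (λ k → N k p * (- δ i k))
            ≡⟨ cong (λ x → 0ℚ * α p - x) (trans
                 (sum-cong λ k → solve 2 (λ a i → a :* (:- i) := i :* (:- a)) refl (N k p) (δ i k))
                 (sum-δ i (λ k → - N k p))) ⟩
          0ℚ * α p - (- N i p)
            ≡⟨ solve 2 (λ a x → con 0ℚ :* a :- (:- x) := x) refl (α p) (N i p) ⟩
          N i p
            ≡⟨ border-û p ⟨
          fibreSum comp û p ∎)
          (no-edges (suc p) zero λ (u , v) → ℚ.*-zeroʳ (edgeVector (suc (comp u)) (suc (comp v)) (suc p)))
        entry (suc p) (suc q) = begin
          δ (suc p) (suc q) * α p - sumℚ (λ k → N k p * B k q)
            ≡⟨ cong (λ x → x * α p - sumℚ (λ k → N k p * B k q)) (δ-suc p q) ⟩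
          δ p q * α p - sumℚ (λ k → N k p * B k q)
            ≡⟨ laplacian-sum G multipartite p q ⟨
          sumL (λ (u , v) → edgeVector (comp u) (comp v) p * edgeVector (comp u) (comp v) q) (edges G)
            ≡⟨ sumL-cong (λ (u , v) → cong₂ _*_ (edgeVector-suc u v p) (edgeVector-suc u v q)) (edges G) ⟨
          sumL (X (suc p) (suc q)) (edges G)
            ≡⟨ ℚ.+-identityˡ (sumL (X (suc p) (suc q)) (edges G)) ⟨
          0ℚ + sumL (X (suc p) (suc q)) (edges G) ∎

      det-perturbed : (∀ p → α p ≢ 0ℚ) →
        prodℚ α * (det M + t * cofactor M i j) ≡ det (bordered (edges G) comp)
      det-perturbed α≢0 = begin
        prodℚ α * (det M + t * cofactor M i j)
          ≡⟨ cong₂ _*_ (ℚ.*-identityˡ (prodℚ α)) (det-add-entry M i j t) ⟨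
        prodℚ d⁺ * det (λ k l → M k l + t * (δ i k * δ j l))
          ≡⟨ cong (prodℚ d⁺ *_) (det-cong perturbed-entry) ⟨
        prodℚ d⁺ * det (λ k l → δ k l - sumℚ (λ p → B⁺ k p * e⁺ p * A⁺ p l))
          ≡⟨ weinstein-aronszajn d⁺ e⁺ d⁺e⁺≡1 A⁺ B⁺ ⟩
        det (λ p q → diag d⁺ p q - sumℚ (λ k → A⁺ p k * B⁺ k q))
          ≡⟨ det-cong reduced-entry ⟩
        det (bordered (edges G) comp) ∎
        where
        d⁺e⁺≡1 : ∀ p → d⁺ p * e⁺ p ≡ 1ℚ
        d⁺e⁺≡1 zero    = refl
        d⁺e⁺≡1 (suc p) = inv-inverse (α≢0 p)

  module _ (vertexIn : ∀ k → ∃ λ v → part v ≡ k) where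

    nᵢ-pos : ∀ k → 0ℚ ℚ.< ℕ→ℚ (nᵢ part k)
    nᵢ-pos k with vertexIn k
    ... | v , refl = subst (0ℚ ℚ.<_) (sym (nᵢ-sum k))
      (sum-pos (λ u → δ (part u) k) (λ u → subst (0ℚ ℚ.≤_) (ℚ.*-identityʳ (δ (part u) k)) (δ-*-nonNeg (part u) k (ℚ.<⇒≤ 0<1)))
        v (subst (0ℚ ℚ.<_) (sym (δ-refl k)) 0<1))

    -- Because 2 ≤ s there is a second part, and it has a vertex, which lies outside part `k`.
    degree-pos : 2 ≤ s → ∀ k → 0ℚ ℚ.< degree k
    degree-pos 2≤s k with other 2≤s k
      where
      other : ∀ {s} → 2 ≤ s → (k : Fin s) → ∃ λ l → l ≢ k
      other (s≤s (s≤s _)) zero    = suc zero , λ ()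
      other (s≤s (s≤s _)) (suc _) = zero , λ ()
    ... | l , l≢k with vertexIn l
    ...   | v , refl = subst (0ℚ ℚ.<_) (sym (degree-sum k))
      (sum-pos (λ u → 1ℚ - δ (part u) k) (λ u → 1-δ-nonNeg (part u) k) v
        (subst (λ x → 0ℚ ℚ.< 1ℚ - x) (sym (δ-≢ l≢k)) 0<1))

    α-pos : 2 ≤ s → (∀ p → ∃ λ v → comp v ≡ p) → ∀ p → 0ℚ ℚ.< α p
    α-pos 2≤s surjective p with surjective p
    ... | v , refl = subst (0ℚ ℚ.<_) (sym (α-sum p))
      (sum-pos (λ u → δ (comp u) p * degree (part u)) (λ u → δ-*-nonNeg (comp u) p (ℚ.<⇒≤ (degree-pos 2≤s (part u)))) v
        (subst (λ x → 0ℚ ℚ.< x * degree (part v)) (sym (δ-refl p))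
          (subst (0ℚ ℚ.<_) (sym (ℚ.*-identityˡ (degree (part v)))) (degree-pos 2≤s (part v)))))

-- Spanning trees of the multipartite graph that contain the forest

theorem4p5 : (s : ℕ) → 2 ≤ s → (n : ℕ) (part : Fin n → Fin s) →
    (∀ i → 1 ≤ nᵢ part i) →
    (G : Graph n) → IsCompleteMultipartite part G →
    (F : Graph n) → IsSpanningForest G F →
    (c : ℕ) (comp : Fin n → Fin c) → IsComponentLabelling F comp →
    let open Setup part comp in
    ∃ λ (τ : ℕ) →
    HasSize [ T ∈ Graph n ∣ IsSpanningTree G T × F ⊆ᴳ T ] τ ×
    (∀ (i j : Fin s) →
    ℕ→ℚ τ ≡ (cofactor M i j ÷₀ (ℕ→ℚ (nᵢ part i) * (ℕ→ℚ n - ℕ→ℚ (nᵢ part j)))) * prodℚ α)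
theorem4p5 (suc s) 2≤s n part nonempty G multipartite F forest zero comp labelling
  -- `det-bordered` needs a label. Without labels there would be no vertices, but part zero has one.
  with count-witness (λ v → ⌊ part v ≟ zero ⌋) (nonempty zero)
... | v , _ with comp v
...   | ()
theorem4p5 s 2≤s n part nonempty G multipartite F (F-simple , F⊆G , F-acyclic) (suc c) comp (reachable , surjective) =
  length ts ,
  enumerated-size (Vec.≡-dec (Vec.≡-dec Bool._≟_)) ts (trees-unique (edges G) (edges-distinct G) L)
    (extends⇒spanning ∘ trees-sound (edges G) L) (trees-complete (edges G) L ∘ spanning⇒extends) ,
  formula
  where
  open Setup part comp
  open Counting part comp

  G-simple : IsSimple G
  G-simple = (λ u v uv → Equivalence.from (multipartite v u) (Equivalence.to (multipartite u v) uv ∘ sym))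
           , (λ u uu → Equivalence.to (multipartite u u) uu refl)

  L : Labelled F comp
  L = record
    { simple     = F-simple
    ; bridges    = acyclic⇒bridges F F-simple F-acyclic
    ; connect    = λ u v eq → reach⇒star (Equivalence.to (reachable u v) eq)
    ; constant   = λ u v uv → Equivalence.from (reachable u v) (step uv here)
    ; surjective = surjective
    }

  ts : List (Graph n)
  ts = trees (edges G) F comp

  extends⇒spanning : ∀ {T} → Extends (edges G) F T → IsSpanningTree G T × F ⊆ᴳ T
  extends⇒spanning X = (simple , (λ u v uv → Sum.[ F⊆G u v , edges-sound G G-simple ] (within u v uv)) , connected , acyclic) , contains
    where open Extends X

  spanning⇒extends : ∀ {T} → IsSpanningTree G T × F ⊆ᴳ T → Extends (edges G) F T
  spanning⇒extends ((simple , T⊆G , connected , acyclic) , F⊆T) = record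
    { simple = simple ; connected = connected ; acyclic = acyclic ; contains = F⊆T
    ; within = λ u v uv → inj₂ (edges-complete G G-simple (T⊆G u v uv)) }

  vertexIn : ∀ k → ∃ λ v → part v ≡ k
  vertexIn k with count-witness (λ v → ⌊ part v ≟ k ⌋) (nonempty k)
  ... | v , eq with part v ≟ k
  ...   | yes v∈k = v , v∈k

  module _ (i j : Fin s) where

    Δ : ℚ
    Δ = ℕ→ℚ (nᵢ part i) * degree j

    Δ≢0 : Δ ≢ 0ℚ
    Δ≢0 = ℚ.<⇒≢ (ℚ.positive⁻¹ Δ {{ℚ.pos*pos⇒pos (ℕ→ℚ (nᵢ part i)) {{ℚ.positive (nᵢ-pos vertexIn i)}}
                                       (degree j) {{ℚ.positive (degree-pos vertexIn 2≤s j)}}}}) ∘ sym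

    linear : ∀ t → prodℚ α * (det M + t * cofactor M i j) ≡ t * (Δ * ℕ→ℚ (length ts))
    linear t = begin
      prodℚ α * (det M + t * cofactor M i j)
        ≡⟨ det-perturbed G multipartite (λ p α≡0 → ℚ.<⇒≢ (α-pos vertexIn 2≤s surjective p) (sym α≡0)) ⟩
      det (bordered (edges G) comp)
        ≡⟨ det-bordered (edges G) F comp ⟩
      - (sumℚ û * sumℚ v̂) * ℕ→ℚ (length ts)
        ≡⟨ cong₂ (λ x y → - (x * y) * ℕ→ℚ (length ts)) sum-û sum-v̂ ⟩
      - (ℕ→ℚ (nᵢ part i) * (- t * degree j)) * ℕ→ℚ (length ts)
        ≡⟨ solve 4 (λ x t d τ → (:- (x :* ((:- t) :* d))) :* τ := t :* ((x :* d) :* τ)) refl (ℕ→ℚ (nᵢ part i)) t (degree j) (ℕ→ℚ (length ts)) ⟩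
      t * (Δ * ℕ→ℚ (length ts)) ∎
      where open Border i j t

    formula : ℕ→ℚ (length ts) ≡ (cofactor M i j ÷₀ Δ) * prodℚ α
    formula = begin
      τ
        -- The factors 1 and 0 prepare the difference of the right-hand sides of `linear 1ℚ` and
        -- `linear 0ℚ`, in which det M cancels.
        ≡⟨ solve 1 (λ τ → τ := con 1ℚ :* (con 1ℚ :* τ) :- con 0ℚ :* τ) refl τ ⟩
      1ℚ * (1ℚ * τ) - 0ℚ * τ
        ≡⟨ cong (λ x → 1ℚ * (x * τ) - 0ℚ * τ) (inv-inverse Δ≢0) ⟨
      1ℚ * (Δ * inv Δ * τ) - 0ℚ * τ
        ≡⟨ solve 3 (λ d e τ → con 1ℚ :* (d :* e :* τ) :- con 0ℚ :* τ := e :* (con 1ℚ :* (d :* τ) :- con 0ℚ :* (d :* τ))) refl Δ (inv Δ) τ ⟩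
      inv Δ * (1ℚ * (Δ * τ) - 0ℚ * (Δ * τ))
        ≡⟨ cong₂ (λ x y → inv Δ * (x - y)) (linear 1ℚ) (linear 0ℚ) ⟨
      inv Δ * (prodℚ α * (det M + 1ℚ * C) - prodℚ α * (det M + 0ℚ * C))
        ≡⟨ solve 4 (λ e α D C → e :* (α :* (D :+ con 1ℚ :* C) :- α :* (D :+ con 0ℚ :* C)) := C :* e :* α) refl (inv Δ) (prodℚ α) (det M) C ⟩
      (C ÷₀ Δ) * prodℚ α ∎
      where
      τ = ℕ→ℚ (length ts)
      C = cofactor M i j
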